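{- Let $m\ge 2$ and $n\ge 2$ be integers, let $T$ be a tree on $n$ vertices, and let $G=T\,\Box\,K_m$ be the Cartesian product of $T$ with the complete graph $K_m$ on $m$ vertices. Then $G$ is just a frame graph in the inner product spaces of dimension $mn-m,mn-m+1,\dots,mn-1,mn$; that is, for each $\mathbb{F}\in\{\mathbb{R},\mathbb{C}\}$ and each integer $d\ge1$, $G$ is a frame graph in a $d$-dimensional inner product space over $\mathbb{F}$ if and only if $mn-m\le d\le mn$.
   Context: All graphs are finite, simple, connected and have more than one vertex. A finite frame for a finite-dimensional inner product space $\mathcal{H}$ over $\mathbb{R}$ or $\mathbb{C}$ is a finite sequence $\varphi=(f_i)_{i=1}^N$ in $\mathcal{H}$ for which there are constants $0<A\le B<\infty$ with $A\|f\|^2\le\sum_{i=1}^N|\langle f,f_i\rangle|^2\le B\|f\|^2$ for all $f\in\mathcal{H}$ (equivalently, a finite sequence spanning $\mathcal{H}$; repeated vectors are allowed and count as different vertices). Its frame graph $G(\varphi)$ has the elements $f_1,\dots,f_N$ of the sequence as vertices, and for $i\ne j$, $f_i$ and $f_j$ are adjacent iff $\langle f_i,f_j\rangle\ne 0$. A graph $G$ is a frame graph in $\mathcal{H}$ if there is a finite frame $\varphi$ for $\mathcal{H}$ with $G(\varphi)=G$ (up to labelling of vertices). The Cartesian product $G_1\,\Box\,G_2$ of $G_1=(V_1,E_1)$ and $G_2=(V_2,E_2)$ has vertex set $V_1\times V_2$, with $(u,v)$ adjacent to $(u',v')$ iff (1) $u=u'$ and $\{v,v'\}\in E_2$, or (2)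 $v=v'$ and $\{u,u'\}\in E_1$. -}

module Defs where

open import Level using (Level; 0ℓ; suc; _⊔_)
open import Algebra.Bundles using (AbelianGroup; CommutativeRing)
open import Algebra.Module.Bundles using (LeftModule)
open import Algebra.Structures using (IsCommutativeRing)
open import Data.Fin.Base using (Fin)
import Data.Fin.Properties as Fin
open import Data.List.Base using (List; []; _∷_)
open import Data.List.Relation.Unary.Unique.Propositional using (Unique)
open import Data.Nat.Base as ℕ using (ℕ)
open import Data.Product.Base using (Σ; ∃; ∃-syntax; _×_; _,_; proj₁; proj₂)
open import Data.Sum.Base using (_⊎_; inj₁; inj₂)
open import Function.Base using (id; _∘_)
open import Function.Bundles using (_↔_; _⇔_; Inverse)
open import Relation.Binary.Core using (Rel)
open import Relation.Binary.Definitions using (Decidable; Symmetric)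
open import Relation.Binary.PropositionalEquality.Core using (_≡_; _≢_; refl; sym; ≢-sym)
open import Relation.Binary.Structures using (IsDecTotalOrder)
open import Relation.Nullary.Decidable using (¬?; _×-dec_; _⊎-dec_)
open import Relation.Nullary.Negation using (¬_)
import Algebra.Construct.DirectProduct as DirectProduct
import Algebra.Properties.CommutativeMonoid.Sum as Sum
import Algebra.Properties.Ring as RingProperties
import Algebra.Solver.Ring.NaturalCoefficients.Default as RingSolver
import Relation.Binary.Construct.NonStrictToStrict as NonStrictToStrict

-- The standard library has no real numbers.  They are specified by the
-- axioms of a Dedekind-complete ordered field, which determine them up
-- to a unique isomorphism.  The order is decidable, as it is in
-- classical mathematics.
record RealNumbers : Set₁ where
  infix 4 _≤_
  field
    commutativeRing : CommutativeRing 0ℓ 0ℓ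

  open CommutativeRing commutativeRing public

  field
    1≉0             : ¬ (1# ≈ 0#)
    inverse         : ∀ x → ¬ (x ≈ 0#) → ∃[ y ] x * y ≈ 1#
    _≤_             : Rel Carrier 0ℓ
    isDecTotalOrder : IsDecTotalOrder _≈_ _≤_
    +-monoˡ-≤       : ∀ z {x y} → x ≤ y → x + z ≤ y + z
    *-nonNegative   : ∀ {x y} → 0# ≤ x → 0# ≤ y → 0# ≤ x * y

  open IsDecTotalOrder isDecTotalOrder public using (_≟_; _≤?_)
  open NonStrictToStrict _≈_ _≤_ public using (_<_)

  UpperBound : (Carrier → Set) → Carrier → Set
  UpperBound P b = ∀ x → P x → x ≤ b

  field
    complete : (P : Carrier → Set) → ∃ P → ∃ (UpperBound P) →
               ∃[ s ] UpperBound P s × (∀ b → UpperBound P b → s ≤ b)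

-- The part of the structure of ℝ and ℂ that the definitions of inner
-- product and frame graph use.  Its few laws do not characterise ℝ and
-- ℂ: results are stated for the two instances below.
record Scalars (ℝ : RealNumbers) : Set₁ where
  private module ℝ = RealNumbers ℝ
  field
    commutativeRing : CommutativeRing 0ℓ 0ℓ

  open CommutativeRing commutativeRing public

  field
    _≟_       : Decidable _≈_
    conj      : Carrier → Carrier
    re        : Carrier → ℝ.Carrier
    conj-cong : ∀ {x y} → x ≈ y → conj x ≈ conj y
    conj-0#   : conj 0# ≈ 0#

  ∣_∣² : Carrier → ℝ.Carrier
  ∣ z ∣² = re (z * conj z)

realScalars : (ℝ : RealNumbers) → Scalars ℝ
realScalars ℝ = record
  { commutativeRing = ℝ.commutativeRing
  ; _≟_             = ℝ._≟_
  ; conj            = id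
  ; re              = id
  ; conj-cong       = id
  ; conj-0#         = ℝ.refl
  }
  where module ℝ = RealNumbers ℝ

-- The pair (a , b) stands for a + bi.
module Complex (ℝ : RealNumbers) where
  open RealNumbers ℝ using (Carrier; _≈_; _+_; _*_; -_; 0#; 1#)
  private module ℝ = RealNumbers ℝ

  additive : AbelianGroup 0ℓ 0ℓ
  additive = DirectProduct.abelianGroup ℝ.+-abelianGroup ℝ.+-abelianGroup

  open AbelianGroup additive public
    using ()
    renaming (Carrier to ℂ; _≈_ to _≈ᶜ_; _∙_ to _+ᶜ_; ε to 0ᶜ; _⁻¹ to -ᶜ_)

  infixl 7 _*ᶜ_
  _*ᶜ_ : ℂ → ℂ → ℂ
  (a , b) *ᶜ (c , d) = a * c + - (b * d) , a * d + b * c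

  1ᶜ : ℂ
  1ᶜ = 1# , 0#

  private
    open RingSolver ℝ.commutativeSemiring using (solve; _:+_; _:*_; _:=_)
    open RingProperties ℝ.ring using (-0#≈0#; -1*x≈-x)

    neg : ∀ x → - x ≈ - 1# * x
    neg x = ℝ.sym (-1*x≈-x x)

    cong : ∀ {x y u v} → x ≈ᶜ y → u ≈ᶜ v → (x *ᶜ u) ≈ᶜ (y *ᶜ v)
    cong (p , q) (r , s) =
      ℝ.+-cong (ℝ.*-cong p r) (ℝ.-‿cong (ℝ.*-cong q s)) ,
      ℝ.+-cong (ℝ.*-cong p s) (ℝ.*-cong q r)

    assoc : ∀ x y z → ((x *ᶜ y) *ᶜ z) ≈ᶜ (x *ᶜ (y *ᶜ z))
    assoc (a , b) (c , d) (e , f) =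
      ℝ.trans (ℝ.+-cong (ℝ.*-congʳ (ℝ.+-congˡ (neg _))) (neg _)) (ℝ.trans
        (solve 7 (λ n a b c d e f →
          (a :* c :+ n :* (b :* d)) :* e :+ n :* ((a :* d :+ b :* c) :* f) :=
          a :* (c :* e :+ n :* (d :* f)) :+ n :* (b :* (c :* f :+ d :* e)))
          ℝ.refl (- 1#) a b c d e f)
        (ℝ.sym (ℝ.+-cong (ℝ.*-congˡ (ℝ.+-congˡ (neg _))) (neg _)))) ,
      ℝ.trans (ℝ.+-congʳ (ℝ.*-congʳ (ℝ.+-congˡ (neg _)))) (ℝ.trans
        (solve 7 (λ n a b c d e f →
          (a :* c :+ n :* (b :* d)) :* f :+ (a :* d :+ b :* c) :* e :=
          a :* (c :* f :+ d :* e) :+ b :* (c :* e :+ n :* (d :* f)))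
          ℝ.refl (- 1#) a b c d e f)
        (ℝ.sym (ℝ.+-congˡ (ℝ.*-congˡ (ℝ.+-congˡ (neg _))))))

    comm : ∀ x y → (x *ᶜ y) ≈ᶜ (y *ᶜ x)
    comm (a , b) (c , d) =
      ℝ.+-cong (ℝ.*-comm a c) (ℝ.-‿cong (ℝ.*-comm b d)) ,
      ℝ.trans (ℝ.+-comm (a * d) (b * c))
              (ℝ.+-cong (ℝ.*-comm b c) (ℝ.*-comm a d))

    identityˡ : ∀ x → (1ᶜ *ᶜ x) ≈ᶜ x
    identityˡ (a , b) =
      ℝ.trans
        (ℝ.+-cong (ℝ.*-identityˡ a)
                  (ℝ.trans (ℝ.-‿cong (ℝ.zeroˡ b)) -0#≈0#))
        (ℝ.+-identityʳ a) ,
      ℝ.trans (ℝ.+-cong (ℝ.*-identityˡ b) (ℝ.zeroˡ a)) (ℝ.+-identityʳ b)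

    distribˡ : ∀ x y z → (x *ᶜ (y +ᶜ z)) ≈ᶜ ((x *ᶜ y) +ᶜ (x *ᶜ z))
    distribˡ (a , b) (c , d) (e , f) =
      ℝ.trans (ℝ.+-congˡ (neg _)) (ℝ.trans
        (solve 7 (λ n a b c d e f →
          a :* (c :+ e) :+ n :* (b :* (d :+ f)) :=
          (a :* c :+ n :* (b :* d)) :+ (a :* e :+ n :* (b :* f)))
          ℝ.refl (- 1#) a b c d e f)
        (ℝ.sym (ℝ.+-cong (ℝ.+-congˡ (neg _)) (ℝ.+-congˡ (neg _))))) ,
      solve 6 (λ a b c d e f →
        a :* (d :+ f) :+ b :* (c :+ e) :=
        (a :* d :+ b :* c) :+ (a :* f :+ b :* e))
        ℝ.refl a b c d e f

  isCommutativeRing : IsCommutativeRing _≈ᶜ_ _+ᶜ_ _*ᶜ_ -ᶜ_ 0ᶜ 1ᶜ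
  isCommutativeRing = record
    { isRing = record
      { +-isAbelianGroup = A.isAbelianGroup
      ; *-cong           = cong
      ; *-assoc          = assoc
      ; *-identity       =
          identityˡ , λ x → A.trans (comm x 1ᶜ) (identityˡ x)
      ; distrib          =
          distribˡ ,
          λ x y z → A.trans (comm (y +ᶜ z) x)
                   (A.trans (distribˡ x y z) (A.∙-cong (comm x y) (comm x z)))
      }
    ; *-comm = comm
    }
    where module A = AbelianGroup additive

complexScalars : (ℝ : RealNumbers) → Scalars ℝ
complexScalars ℝ = record
  { commutativeRing = record { isCommutativeRing = isCommutativeRing }
  ; _≟_             = λ (a , b) (c , d) → (a ℝ.≟ c) ×-dec (b ℝ.≟ d)
  ; conj            = λ (a , b) → a , ℝ.- b
  ; re              = proj₁
  ; conj-cong       = λ (p , q) → p , ℝ.-‿cong q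
  ; conj-0#         = ℝ.refl , -0#≈0#
  }
  where
  module ℝ = RealNumbers ℝ
  open RingProperties ℝ.ring using (-0#≈0#)
  open Complex ℝ using (isCommutativeRing)

data ScalarField : Set where
  real complex : ScalarField

scalars : (ℝ : RealNumbers) → ScalarField → Scalars ℝ
scalars ℝ real    = realScalars ℝ
scalars ℝ complex = complexScalars ℝ

record InnerProductSpace {ℝ : RealNumbers} (𝔽 : Scalars ℝ) (a ℓ : Level)
       : Set (suc (a ⊔ ℓ)) where
  private
    module ℝ = RealNumbers ℝ
    module 𝔽 = Scalars 𝔽
  field
    vectorSpace : LeftModule 𝔽.ring a ℓ

  open LeftModule vectorSpace public

  field
    ⟨_,_⟩     : Carrierᴹ → Carrierᴹ → 𝔽.Carrier
    ⟨⟩-cong   : ∀ {x x′ y y′} → x ≈ᴹ x′ → y ≈ᴹ y′ → ⟨ x , y ⟩ 𝔽.≈ ⟨ x′ , y′ ⟩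
    ⟨⟩-+ˡ     : ∀ x y z → ⟨ x +ᴹ y , z ⟩ 𝔽.≈ ⟨ x , z ⟩ 𝔽.+ ⟨ y , z ⟩
    ⟨⟩-*ˡ     : ∀ c x y → ⟨ c *ₗ x , y ⟩ 𝔽.≈ c 𝔽.* ⟨ x , y ⟩
    ⟨⟩-conj   : ∀ x y → ⟨ x , y ⟩ 𝔽.≈ 𝔽.conj ⟨ y , x ⟩
    -- By ⟨⟩-conj the scalar ⟨ x , x ⟩ is real.
    ⟨⟩-nonNeg : ∀ x → ℝ.0# ℝ.≤ 𝔽.re ⟨ x , x ⟩
    ⟨⟩-def    : ∀ x → ⟨ x , x ⟩ 𝔽.≈ 𝔽.0# → x ≈ᴹ 0ᴹ

  ∥_∥² : Carrierᴹ → ℝ.Carrier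
  ∥ x ∥² = 𝔽.re ⟨ x , x ⟩

  combination : ∀ {k} → (Fin k → 𝔽.Carrier) → (Fin k → Carrierᴹ) → Carrierᴹ
  combination c e = Sum.sum +ᴹ-commutativeMonoid (λ i → c i *ₗ e i)

  LinearlyIndependent : ∀ {k} → (Fin k → Carrierᴹ) → Set ℓ
  LinearlyIndependent e =
    ∀ c → combination c e ≈ᴹ 0ᴹ → ∀ i → c i 𝔽.≈ 𝔽.0#

  Spanning : ∀ {k} → (Fin k → Carrierᴹ) → Set (a ⊔ ℓ)
  Spanning e = ∀ x → ∃[ c ] x ≈ᴹ combination c e

  HasDimension : ℕ → Set (a ⊔ ℓ)
  HasDimension d =
    Σ (Fin d → Carrierᴹ) λ e → LinearlyIndependent e × Spanning e

  IsFrame : ∀ {N} → (Fin N → Carrierᴹ) → Set a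
  IsFrame φ =
    ∃[ A ] ∃[ B ] ℝ.0# ℝ.< A × A ℝ.≤ B ×
      (∀ f → A ℝ.* ∥ f ∥² ℝ.≤ ℝ-sum (λ i → 𝔽.∣ ⟨ f , φ i ⟩ ∣²)
           × ℝ-sum (λ i → 𝔽.∣ ⟨ f , φ i ⟩ ∣²) ℝ.≤ B ℝ.* ∥ f ∥²)
    where ℝ-sum = Sum.sum ℝ.+-commutativeMonoid

record SimpleGraph (V : Set) : Set₁ where
  infix 4 _~_
  field
    _~_       : Rel V 0ℓ
    symmetric : Symmetric _~_
    loopless  : ∀ {v} → ¬ (v ~ v)
    adjacent? : Decidable _~_

module _ {V : Set} (G : SimpleGraph V) where
  open SimpleGraph G

  infixr 5 _∷_
  data Walk : V → V → Set where
    []  : ∀ {u} → Walk u u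
    _∷_ : ∀ {u v w} → u ~ v → Walk v w → Walk u w

  vertices : ∀ {u v} → Walk u v → List V
  vertices {u} []      = u ∷ []
  vertices {u} (_ ∷ w) = u ∷ vertices w

  length : ∀ {u v} → Walk u v → ℕ
  length []      = 0
  length (_ ∷ w) = ℕ.suc (length w)

  IsPath : ∀ {u v} → Walk u v → Set
  IsPath w = Unique (vertices w)

  -- A cycle is an edge u ~ v followed by a path of length at least two
  -- from v back to u; the bound excludes traversing one edge twice.
  HasCycle : Set
  HasCycle = ∃[ u ] ∃[ v ] u ~ v ×
             Σ (Walk v u) λ p → IsPath p × 2 ℕ.≤ length p

  IsTree : Set
  IsTree = (∀ u v → Walk u v) × ¬ HasCycle

record _≅_ {V W : Set} (G : SimpleGraph V) (H : SimpleGraph W) : Set where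
  private
    module G = SimpleGraph G
    module H = SimpleGraph H
  field
    bijection : V ↔ W
  open Inverse bijection public using (to)
  field
    adjacent : ∀ u v → u G.~ v ⇔ to u H.~ to v

complete : (m : ℕ) → SimpleGraph (Fin m)
complete m = record
  { _~_       = _≢_
  ; symmetric = ≢-sym
  ; loopless  = λ v≢v → v≢v refl
  ; adjacent? = λ u v → ¬? (u Fin.≟ v)
  }

infixr 6 _□_
_□_ : ∀ {m n} → SimpleGraph (Fin m) → SimpleGraph (Fin n) →
      SimpleGraph (Fin m × Fin n)
G₁ □ G₂ = record
  { _~_       = λ (u , v) (u′ , v′) →
                  (u ≡ u′ × v G₂.~ v′) ⊎ (v ≡ v′ × u G₁.~ u′)
  ; symmetric = λ
      { (inj₁ (p , q)) → inj₁ (sym p , G₂.symmetric q)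
      ; (inj₂ (p , q)) → inj₂ (sym p , G₁.symmetric q)
      }
  ; loopless  = λ
      { (inj₁ (_ , q)) → G₂.loopless q
      ; (inj₂ (_ , q)) → G₁.loopless q
      }
  ; adjacent? = λ (u , v) (u′ , v′) →
      ((u Fin.≟ u′) ×-dec G₂.adjacent? v v′) ⊎-dec
      ((v Fin.≟ v′) ×-dec G₁.adjacent? u u′)
  }
  where
  module G₁ = SimpleGraph G₁
  module G₂ = SimpleGraph G₂

module _ {ℝ : RealNumbers} {𝔽 : Scalars ℝ} {a ℓ : Level}
         (H : InnerProductSpace 𝔽 a ℓ) where
  open InnerProductSpace H
  private module 𝔽 = Scalars 𝔽

  frameGraph : ∀ {N} → (Fin N → Carrierᴹ) → SimpleGraph (Fin N)
  frameGraph φ = record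
    { _~_       = λ i j → i ≢ j × ¬ (⟨ φ i , φ j ⟩ 𝔽.≈ 𝔽.0#)
    ; symmetric = λ (i≢j , φi⊥̸φj) → ≢-sym i≢j , φi⊥̸φj ∘ ⊥-sym
    ; loopless  = λ (i≢i , _) → i≢i refl
    ; adjacent? = λ i j → ¬? (i Fin.≟ j) ×-dec ¬? (⟨ φ i , φ j ⟩ 𝔽.≟ 𝔽.0#)
    }
    where
    ⊥-sym : ∀ {x y} → ⟨ x , y ⟩ 𝔽.≈ 𝔽.0# → ⟨ y , x ⟩ 𝔽.≈ 𝔽.0#
    ⊥-sym x⊥y =
      𝔽.trans (⟨⟩-conj _ _) (𝔽.trans (𝔽.conj-cong x⊥y) 𝔽.conj-0#)

  IsFrameGraph : ∀ {V} → SimpleGraph V → Set a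
  IsFrameGraph G =
    ∃[ N ] Σ (Fin N → Carrierᴹ) λ φ → IsFrame φ × frameGraph φ ≅ G

module Submission where

open import Defs
open import Data.Bool.Base using (Bool; true; false; not)
open import Data.Fin.Base
  using (Fin; zero; suc; fromℕ<; punchIn; punchOut; combine; remQuot; splitAt; _↑ˡ_; _↑ʳ_)
open import Data.Fin.Permutation using (↔⇒≡)
import Data.Fin.Properties as Fin
open import Data.List.Base using ([]; _∷_)
import Data.List.Membership.DecPropositional as DecMembership
open import Data.List.Membership.Propositional using (_∈_)
open import Data.List.Relation.Binary.Subset.Propositional using (_⊆_)
open import Data.List.Relation.Unary.All as All using (All; []; _∷_)
import Data.List.Relation.Unary.All.Properties as All
open import Data.List.Relation.Unary.AllPairs using ([]; _∷_)
open import Data.List.Relation.Unary.Any using (here; there)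
open import Data.Nat.Base as ℕ using (ℕ; zero; suc; z≤n; s≤s)
import Data.Nat.Properties as ℕ
open import Data.Product.Base
  using (Σ-syntax; ∃-syntax; _×_; _,_; proj₁; proj₂; uncurry)
open import Data.Sum.Base using (_⊎_; inj₁; inj₂; [_,_]′)
import Data.Vec.Functional as Vector
open import Function.Base using (id; _∘_)
open import Function.Bundles using (_⇔_; mk⇔; Inverse; Equivalence)
open import Function.Construct.Composition using (_↔-∘_)
open import Function.Construct.Symmetry using (↔-sym)
open import Function.Definitions using (Injective)
open import Level using (Level; _⊔_) renaming (suc to lsuc)
open import Relation.Binary.PropositionalEquality.Core as ≡ using (_≡_; _≢_)
open import Relation.Binary.Structures using (IsDecTotalOrder)
open import Relation.Nullary.Decidable using (Dec; yes; no; ¬?; map′; decidable-stable)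
open import Relation.Nullary.Negation using (¬_; contradiction)
import Algebra.Properties.CommutativeMonoid.Sum as Sum
import Algebra.Properties.Ring as RingProperties
import Algebra.Properties.Semiring.Sum as SemiringSum
import Algebra.Solver.Ring.NaturalCoefficients.Default as RingSolver
import Relation.Binary.Reasoning.Setoid as SetoidReasoning

-- Lower bound.  Root T; the vectors outside the copy of K_m at the root are
-- linearly independent.  Remove a leaf of T and project the other vectors onto
-- the orthogonal complement of its copy: only the copy at its neighbour changes,
-- and inner products between different copies do not.  So a linear relation is
-- trivial off the leaf by induction, and at the leaf by pairing the relation
-- with the copy at its neighbour.
--
-- Construction.  Give each edge of T its own m-dimensional space, carrying a
-- pair of families that are dual up to scaling: the first has positive inner
-- products between distinct members, the second negative ones.  Vertices of one
-- class of the bipartition of T use the first family on all their edges, the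
-- others the second, so that within a copy nothing cancels.  This realises the
-- dimension mn - m; adding up to m further orthogonal directions to the vectors
-- at the root gives the other dimensions.

-- Real and complex scalars

-- The dual pair of families comes from a rank-one perturbation of the identity. Let ε_j be an
-- orthogonal basis of the space of an edge, h its sum, w_j and W the squared norms of ε_j and h.
-- The self-adjoint map S x = x + <x, h> h sends ε_j to ε_j + w_j h, and by the Sherman-Morrison
-- formula (1 + W) times the inverse of S sends ε_j to (1 + W) ε_j - w_j h. Self-adjointness makes
-- the two images biorthogonal up to positive factors, while the term in h gives each of them inner
-- products of one strict sign. A frame is given by two inequalities, not by spanning. The lower one
-- usually rests on compactness of the unit sphere; here the vectors whose coefficients are
-- controlled by the frame sum form a subspace, which yields an explicit constant. Only squared
-- norms occur, so that no square root is taken.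

module OrderedField (ℝ : RealNumbers) where
  open RealNumbers ℝ hiding (zero)
  open RingProperties ring using (-‿distribˡ-*; -‿distribʳ-*; -‿involutive)
  open Sum +-commutativeMonoid public using (sum; sum-cong-≋; sum-replicate-zero)
  open SemiringSum semiring public using (*-distribˡ-sum; *-distribʳ-sum)
  open RingSolver commutativeSemiring using (solve; _:+_; _:*_; _:=_)

  module ≤ = IsDecTotalOrder isDecTotalOrder

  ≤-resp : ∀ {x x′ y y′} → x ≈ x′ → y ≈ y′ → x ≤ y → x′ ≤ y′
  ≤-resp p q = ≤.≤-respʳ-≈ q ∘ ≤.≤-respˡ-≈ p

  +-mono-≤ : ∀ {x y u v} → x ≤ y → u ≤ v → x + u ≤ y + v
  +-mono-≤ p q = ≤.trans (+-monoˡ-≤ _ p)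
    (≤-resp (+-comm _ _) (+-comm _ _) (+-monoˡ-≤ _ q))

  +-nonNegative : ∀ {x y} → 0# ≤ x → 0# ≤ y → 0# ≤ x + y
  +-nonNegative p q = ≤-resp (+-identityʳ 0#) refl (+-mono-≤ p q)

  ≤+nonNegative : ∀ {x y} → 0# ≤ y → x ≤ x + y
  ≤+nonNegative p = ≤-resp (+-identityʳ _) refl (+-mono-≤ ≤.refl p)

  x≤0⇒0≤-x : ∀ {x} → x ≤ 0# → 0# ≤ - x
  x≤0⇒0≤-x p = ≤-resp (-‿inverseʳ _) (+-identityˡ _) (+-monoˡ-≤ _ p)

  *-monoˡ-≤ : ∀ {x y z} → 0# ≤ z → x ≤ y → z * x ≤ z * y
  *-monoˡ-≤ {x} {y} {z} 0≤z x≤y =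
    ≤-resp (+-identityˡ _) eq (+-monoˡ-≤ (z * x) (*-nonNegative 0≤z 0≤y-x))
    where
    0≤y-x = ≤-resp (-‿inverseʳ x) refl (+-monoˡ-≤ (- x) x≤y)
    eq : z * (y + - x) + z * x ≈ z * y
    eq = trans (sym (distribˡ z _ _)) (*-congˡ
      (trans (+-assoc _ _ _) (trans (+-congˡ (-‿inverseˡ x)) (+-identityʳ y))))

  -x*-y≈x*y : ∀ x y → - x * - y ≈ x * y
  -x*-y≈x*y x y = trans (sym (-‿distribˡ-* _ _))
    (trans (-‿cong (sym (-‿distribʳ-* _ _))) (-‿involutive _))

  square-nonNegative : ∀ x → 0# ≤ x * x
  square-nonNegative x with ≤.total 0# x
  ... | inj₁ p = *-nonNegative p p
  ... | inj₂ p = ≤-resp refl (-x*-y≈x*y x x) (*-nonNegative (x≤0⇒0≤-x p) (x≤0⇒0≤-x p))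

  0≤1 : 0# ≤ 1#
  0≤1 = ≤-resp refl (*-identityˡ 1#) (square-nonNegative 1#)

  0≤2 : 0# ≤ 1# + 1#
  0≤2 = +-nonNegative 0≤1 0≤1

  x+y≈0⇒x≈0 : ∀ {x y} → 0# ≤ x → 0# ≤ y → x + y ≈ 0# → x ≈ 0#
  x+y≈0⇒x≈0 0≤x 0≤y eq = ≤.antisym (≤-resp refl eq (≤+nonNegative 0≤y)) 0≤x

  sum-mono-≤ : ∀ {n} {t u : Fin n → Carrier} → (∀ i → t i ≤ u i) → sum t ≤ sum u
  sum-mono-≤ {zero}  t≤u = ≤.refl
  sum-mono-≤ {suc n} t≤u = +-mono-≤ (t≤u zero) (sum-mono-≤ (t≤u ∘ suc))

  sum-nonNegative : ∀ {n} {t : Fin n → Carrier} → (∀ i → 0# ≤ t i) → 0# ≤ sum t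
  sum-nonNegative {zero}  0≤t = ≤.refl
  sum-nonNegative {suc n} 0≤t = +-nonNegative (0≤t zero) (sum-nonNegative (0≤t ∘ suc))

  term≤sum : ∀ {n} {t : Fin n → Carrier} → (∀ i → 0# ≤ t i) → ∀ i → t i ≤ sum t
  term≤sum 0≤t zero    = ≤+nonNegative (sum-nonNegative (0≤t ∘ suc))
  term≤sum 0≤t (suc i) = ≤.trans (term≤sum (0≤t ∘ suc) i)
    (≤-resp refl (+-comm _ _) (≤+nonNegative (0≤t zero)))

  sum-zero : ∀ {n} {t : Fin n → Carrier} → (∀ i → t i ≈ 0#) → sum t ≈ 0#
  sum-zero {n} t≈0 = trans (sum-cong-≋ t≈0) (sum-replicate-zero n)

  *-cancel-0 : ∀ {x y} → ¬ (x ≈ 0#) → x * y ≈ 0# → y ≈ 0#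
  *-cancel-0 {x} {y} x≉0 xy≈0 = let (z , xz≈1) = inverse x x≉0 in
    trans (sym (*-identityˡ y)) (trans (*-congʳ (sym (trans (*-comm z x) xz≈1)))
      (trans (*-assoc z x y) (trans (*-congˡ xy≈0) (zeroʳ z))))

  square≈0⇒≈0 : ∀ {x} → x * x ≈ 0# → x ≈ 0#
  square≈0⇒≈0 {x} eq with x ≟ 0#
  ... | yes p = p
  ... | no  p = *-cancel-0 p eq

  -- `y` is `x` times the square of `y`.
  nonNegative-inverse : ∀ {x y} → 0# ≤ x → x * y ≈ 1# → 0# ≤ y
  nonNegative-inverse {x} {y} 0≤x xy≈1 =
    ≤-resp refl (trans (sym (*-assoc x y y)) (trans (*-congʳ xy≈1) (*-identityˡ y)))
      (*-nonNegative 0≤x (square-nonNegative y))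

  -- The two sides differ by the square of `x - y`. This replaces the triangle inequality when only
  -- squares are available.
  square-+-≤ : ∀ x y → (x + y) * (x + y) ≤ (1# + 1#) * (x * x + y * y)
  square-+-≤ x y = ≤-resp refl eq (≤+nonNegative (square-nonNegative (x + - y)))
    where
    eq : (x + y) * (x + y) + (x + - y) * (x + - y) ≈ (1# + 1#) * (x * x + y * y)
    eq = trans
      (solve 3 (λ x y z → (x :+ y) :* (x :+ y) :+ (x :+ z) :* (x :+ z) :=
        x :* x :+ x :* x :+ y :* y :+ z :* z :+ (x :+ x) :* (y :+ z))
        refl x y (- y))
      (trans (+-cong (+-congˡ (-x*-y≈x*y y y)) (trans (*-congˡ (-‿inverseʳ y)) (zeroʳ _)))
      (trans (+-identityʳ _) (trans
      (solve 2 (λ x y → x :* x :+ x :* x :+ y :* y :+ y :* y :=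
        (x :* x :+ y :* y) :+ (x :* x :+ y :* y)) refl x y)
      (sym (trans (distribʳ _ _ _) (+-cong (*-identityˡ _) (*-identityˡ _)))))))

-- ι is the inclusion of the real numbers.
record ConjugationLaws {ℝ : RealNumbers} (𝔽 : Scalars ℝ) : Set where
  private module ℝ = RealNumbers ℝ
  open Scalars 𝔽
  field
    ι               : ℝ.Carrier → Carrier
    ι-cong          : ∀ {r s} → r ℝ.≈ s → ι r ≈ ι s
    ι-0#            : ι ℝ.0# ≈ 0#
    ι-1#            : ι ℝ.1# ≈ 1#
    ι-+             : ∀ r s → ι (r ℝ.+ s) ≈ ι r + ι s
    ι-*             : ∀ r s → ι (r ℝ.* s) ≈ ι r * ι s
    re-cong         : ∀ {x y} → x ≈ y → re x ℝ.≈ re y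
    re-ι            : ∀ r → re (ι r) ℝ.≈ r
    conj-ι          : ∀ r → conj (ι r) ≈ ι r
    conj-fixed      : ∀ {z} → conj z ≈ z → z ≈ ι (re z)
    conj-+          : ∀ x y → conj (x + y) ≈ conj x + conj y
    conj-*          : ∀ x y → conj (x * y) ≈ conj x * conj y
    conj-involutive : ∀ z → conj (conj z) ≈ z
    ∣∣²-nonNegative : ∀ z → ℝ.0# ℝ.≤ ∣ z ∣²
    ∣∣²-definite    : ∀ {z} → ∣ z ∣² ℝ.≈ ℝ.0# → z ≈ 0#
    ∣∣²-+-≤         : ∀ x y →
      ∣ x + y ∣² ℝ.≤ (ℝ.1# ℝ.+ ℝ.1#) ℝ.* (∣ x ∣² ℝ.+ ∣ y ∣²)

realLaws : (ℝ : RealNumbers) → ConjugationLaws (realScalars ℝ)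
realLaws ℝ = record
  { ι               = id
  ; ι-cong          = id
  ; ι-0#            = refl
  ; ι-1#            = refl
  ; ι-+             = λ _ _ → refl
  ; ι-*             = λ _ _ → refl
  ; re-cong         = id
  ; re-ι            = λ _ → refl
  ; conj-ι          = λ _ → refl
  ; conj-fixed      = λ _ → refl
  ; conj-+          = λ _ _ → refl
  ; conj-*          = λ _ _ → refl
  ; conj-involutive = λ _ → refl
  ; ∣∣²-nonNegative = square-nonNegative
  ; ∣∣²-definite    = square≈0⇒≈0
  ; ∣∣²-+-≤         = square-+-≤
  }
  where
  open RealNumbers ℝ
  open OrderedField ℝ

complexLaws : (ℝ : RealNumbers) → ConjugationLaws (complexScalars ℝ)
complexLaws ℝ = record
  { ι               = λ r → r , 0#
  ; ι-cong          = λ p → p , refl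
  ; ι-0#            = refl , refl
  ; ι-1#            = refl , refl
  ; ι-+             = λ _ _ → refl , sym (+-identityʳ 0#)
  ; ι-*             = λ r s →
      sym (trans (+-congˡ (trans (-‿cong (zeroˡ 0#)) -0#≈0#)) (+-identityʳ _)) ,
      sym (trans (+-cong (zeroʳ r) (zeroˡ s)) (+-identityʳ 0#))
  ; re-cong         = proj₁
  ; re-ι            = λ _ → refl
  ; conj-ι          = λ _ → refl , -0#≈0#
  ; conj-fixed      = λ (_ , p) → refl , -x≈x⇒x≈0 p
  ; conj-+          = λ (_ , b) (_ , d) → refl , sym (-‿+-comm b d)
  ; conj-*          = λ (a , b) (c , d) →
      +-congˡ (-‿cong (sym (-x*-y≈x*y b d))) ,
      trans (sym (-‿+-comm _ _)) (+-cong (-‿distribʳ-* _ _) (-‿distribˡ-* _ _))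
  ; conj-involutive = λ (_ , b) → refl , -‿involutive b
  ; ∣∣²-nonNegative = λ z → ≤-resp refl (sym (∣∣²≈ z))
      (+-nonNegative (square-nonNegative _) (square-nonNegative _))
  ; ∣∣²-definite    = λ {z} eq → let eq′ = trans (sym (∣∣²≈ z)) eq in
      square≈0⇒≈0 (x+y≈0⇒x≈0 (square-nonNegative _) (square-nonNegative _) eq′) ,
      square≈0⇒≈0 (x+y≈0⇒x≈0 (square-nonNegative _) (square-nonNegative _)
        (trans (+-comm _ _) eq′))
  ; ∣∣²-+-≤         = λ x y → let (a , b) = x ; (c , d) = y in
      ≤-resp (sym (∣∣²≈ (a + c , b + d)))
        (trans (sym (distribˡ _ _ _)) (*-congˡ (trans
          (solve 4 (λ p q r s → (p :+ q) :+ (r :+ s) := (p :+ r) :+ (q :+ s))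
            refl (a * a) (c * c) (b * b) (d * d))
          (sym (+-cong (∣∣²≈ x) (∣∣²≈ y))))))
        (+-mono-≤ (square-+-≤ a c) (square-+-≤ b d))
  }
  where
  open RealNumbers ℝ
  open OrderedField ℝ
  open RingProperties ring
    using (-0#≈0#; -‿+-comm; -‿distribˡ-*; -‿distribʳ-*; -‿involutive)
  open RingSolver commutativeSemiring using (solve; _:+_; _:*_; _:=_)

  ∣∣²≈ : ∀ z → Scalars.∣_∣² (complexScalars ℝ) z ≈ proj₁ z * proj₁ z + proj₂ z * proj₂ z
  ∣∣²≈ (a , b) = +-congˡ (trans (-‿cong (sym (-‿distribʳ-* b b))) (-‿involutive _))

  -- The order excludes characteristic two: either `x` or `- x`, which is the same, is nonnegative,
  -- and twice it is zero.
  -x≈x⇒x≈0 : ∀ {x} → - x ≈ x → x ≈ 0#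
  -x≈x⇒x≈0 {x} eq = x+x≈0 (trans (+-congˡ (sym eq)) (-‿inverseʳ x))
    where
    x+x≈0 : x + x ≈ 0# → x ≈ 0#
    x+x≈0 p with ≤.total 0# x
    ... | inj₁ q = x+y≈0⇒x≈0 q q p
    ... | inj₂ q = x+y≈0⇒x≈0 (≤-resp refl eq (x≤0⇒0≤-x q)) (≤-resp refl eq (x≤0⇒0≤-x q)) p

laws : (ℝ : RealNumbers) (𝔽 : ScalarField) → ConjugationLaws (scalars ℝ 𝔽)
laws ℝ real    = realLaws ℝ
laws ℝ complex = complexLaws ℝ

-- Linear systems and positive scalars

module FieldTheory {ℝ : RealNumbers} (𝔽 : Scalars ℝ) (L : ConjugationLaws 𝔽) where
  open Scalars 𝔽 hiding (zero)
  open ConjugationLaws L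
  open RingProperties ring using (-‿distribˡ-*; -‿distribʳ-*; -‿involutive)
  open RingSolver commutativeSemiring using (solve; _:+_; _:*_; _:=_)
  open Sum +-commutativeMonoid using (sum; sum-cong-≋; ∑-distrib-+)
  open SemiringSum semiring using (*-distribˡ-sum)
  open SetoidReasoning setoid
  private
    module ℝ where
      open RealNumbers ℝ public
      open OrderedField ℝ public

  ι-injective : ∀ {r s} → ι r ≈ ι s → r ℝ.≈ s
  ι-injective eq = ℝ.trans (ℝ.sym (re-ι _)) (ℝ.trans (re-cong eq) (re-ι _))

  1≉0 : ¬ (1# ≈ 0#)
  1≉0 eq = ℝ.1≉0 (ι-injective (trans ι-1# (trans eq (sym ι-0#))))

  z*conj≈ι∣z∣² : ∀ z → z * conj z ≈ ι ∣ z ∣²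
  z*conj≈ι∣z∣² z = conj-fixed
    (trans (conj-* z (conj z)) (trans (*-congˡ (conj-involutive z)) (*-comm _ _)))

  ∣∣²-cong : ∀ {x y} → x ≈ y → ∣ x ∣² ℝ.≈ ∣ y ∣²
  ∣∣²-cong eq = re-cong (*-cong eq (conj-cong eq))

  ∣∣²-* : ∀ x y → ∣ x * y ∣² ℝ.≈ ∣ x ∣² ℝ.* ∣ y ∣²
  ∣∣²-* x y = ι-injective (begin
    ι ∣ x * y ∣²                  ≈⟨ z*conj≈ι∣z∣² (x * y) ⟨
    x * y * conj (x * y)          ≈⟨ *-congˡ (conj-* x y) ⟩
    x * y * (conj x * conj y)     ≈⟨ solve 4 (λ a b c d → a :* b :* (c :* d) := (a :* c) :* (b :* d))
                                       refl x y (conj x) (conj y) ⟩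
    (x * conj x) * (y * conj y)   ≈⟨ *-cong (z*conj≈ι∣z∣² x) (z*conj≈ι∣z∣² y) ⟩
    ι ∣ x ∣² * ι ∣ y ∣²           ≈⟨ ι-* _ _ ⟨
    ι (∣ x ∣² ℝ.* ∣ y ∣²)         ∎)

  ∣0∣² : ∣ 0# ∣² ℝ.≈ ℝ.0#
  ∣0∣² = ι-injective (trans (sym (z*conj≈ι∣z∣² 0#)) (trans (zeroˡ _) (sym ι-0#)))

  inverse : ∀ z → ¬ (z ≈ 0#) → ∃[ w ] z * w ≈ 1#
  inverse z z≉0 with ℝ.inverse ∣ z ∣² (z≉0 ∘ ∣∣²-definite)
  ... | r , eq = conj z * ι r , (begin
    z * (conj z * ι r)   ≈⟨ *-assoc z (conj z) (ι r) ⟨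
    z * conj z * ι r     ≈⟨ *-congʳ (z*conj≈ι∣z∣² z) ⟩
    ι ∣ z ∣² * ι r       ≈⟨ ι-* _ _ ⟨
    ι (∣ z ∣² ℝ.* r)     ≈⟨ ι-cong eq ⟩
    ι ℝ.1#               ≈⟨ ι-1# ⟩
    1#                   ∎)

  *-cancelˡ-0 : ∀ {x y} → ¬ (x ≈ 0#) → x * y ≈ 0# → y ≈ 0#
  *-cancelˡ-0 {x} {y} x≉0 xy≈0 = let (z , xz≈1) = inverse x x≉0 in begin
    y             ≈⟨ *-identityˡ y ⟨
    1# * y        ≈⟨ *-congʳ xz≈1 ⟨
    x * z * y     ≈⟨ solve 3 (λ x y z → x :* z :* y := z :* (x :* y)) refl x y z ⟩
    z * (x * y)   ≈⟨ *-congˡ xy≈0 ⟩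
    z * 0#        ≈⟨ zeroʳ z ⟩
    0#            ∎

  sum-zero : ∀ {n} {t : Fin n → Carrier} → (∀ i → t i ≈ 0#) → sum t ≈ 0#
  sum-zero {zero}  t≈0 = refl
  sum-zero {suc n} t≈0 = trans (+-cong (t≈0 zero) (sum-zero (t≈0 ∘ suc))) (+-identityˡ 0#)

  sum-single : ∀ {n} {t : Fin n → Carrier} j → (∀ i → i ≢ j → t i ≈ 0#) → sum t ≈ t j
  sum-single zero    t≈0 = trans (+-congˡ (sum-zero (λ i → t≈0 (suc i) λ ()))) (+-identityʳ _)
  sum-single (suc j) t≈0 = trans
    (+-cong (t≈0 zero λ ()) (sum-single j (λ i i≢j → t≈0 (suc i) (i≢j ∘ Fin.suc-injective))))
    (+-identityˡ _)

  sum-++ : ∀ m {n} (t : Fin (m ℕ.+ n) → Carrier) →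
    sum t ≈ sum (t ∘ (_↑ˡ n)) + sum (t ∘ (m ↑ʳ_))
  sum-++ zero    t = sym (+-identityˡ _)
  sum-++ (suc m) t = trans (+-congˡ (sum-++ m (t ∘ suc))) (sym (+-assoc _ _ _))

  sum-combine : ∀ k {m} (t : Fin (k ℕ.* m) → Carrier) →
    sum t ≈ sum (λ i → sum (λ j → t (combine {k} i j)))
  sum-combine zero    t = refl
  sum-combine (suc k) {m} t = trans (sum-++ m t) (+-congˡ (sum-combine k (t ∘ (m ↑ʳ_))))

  sum-eliminate : ∀ {n} (a b y : Fin n → Carrier) c →
    sum (λ j → (a j + c * b j) * y j) ≈
    sum (λ j → a j * y j) + c * sum (λ j → b j * y j)
  sum-eliminate a b y c = begin
    sum (λ j → (a j + c * b j) * y j)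
      ≈⟨ sum-cong-≋ (λ j → trans (distribʳ (y j) (a j) (c * b j)) (+-congˡ (*-assoc c (b j) (y j)))) ⟩
    sum (λ j → a j * y j + c * (b j * y j))
      ≈⟨ ∑-distrib-+ (λ j → a j * y j) (λ j → c * (b j * y j)) ⟩
    sum (λ j → a j * y j) + sum (λ j → c * (b j * y j))
      ≈⟨ +-congˡ (*-distribˡ-sum c (λ j → b j * y j)) ⟨
    sum (λ j → a j * y j) + c * sum (λ j → b j * y j)  ∎

  -- Gaussian elimination of the unknown with index zero.
  kernel : ∀ {N d} → N ℕ.< d → (M : Fin N → Fin d → Carrier) →
    Σ[ x ∈ (Fin d → Carrier) ]
      (∃[ i ] ¬ (x i ≈ 0#)) × (∀ r → sum (λ j → M r j * x j) ≈ 0#)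
  kernel {N} {suc d} N<d M with Fin.any? (λ r → ¬? (M r zero ≟ 0#))
  -- Column zero vanishes, so the first unit vector is a solution.
  ... | no none = 1# Vector.∷ (λ _ → 0#) , (zero , 1≉0) , λ r → trans
    (+-cong
      (trans (*-identityʳ _)
        (decidable-stable (M r zero ≟ 0#) (λ Mr0≉0 → none (r , Mr0≉0))))
      (sum-zero (λ j → zeroʳ (M r (suc j)))))
    (+-identityˡ 0#)
  -- Row `r` is the pivot: it is subtracted from the other rows, and afterwards determines `x₀` from
  -- `y`.
  kernel {suc N} {suc d} (s≤s N<d) M | yes (r , Mr0≉0) with inverse _ Mr0≉0
  ... | w , Mr0*w≈1 with kernel N<d (λ t j →
    M (punchIn r t) (suc j) + - (M (punchIn r t) zero * w) * M r (suc j))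
  ... | y , (i , yi≉0) , sol = x₀ Vector.∷ y , (suc i , yi≉0) , solved
    where
    S : Fin (suc N) → Carrier
    S s = sum (λ j → M s (suc j) * y j)

    x₀ : Carrier
    x₀ = - (w * S r)

    M*x₀ : ∀ s → M s zero * x₀ ≈ - (M s zero * w) * S r
    M*x₀ s = begin
      M s zero * - (w * S r)     ≈⟨ -‿distribʳ-* _ _ ⟨
      - (M s zero * (w * S r))   ≈⟨ -‿cong (*-assoc _ _ _) ⟨
      - (M s zero * w * S r)     ≈⟨ -‿distribˡ-* _ _ ⟩
      - (M s zero * w) * S r     ∎

    solved : ∀ s → M s zero * x₀ + S s ≈ 0#
    solved s with r Fin.≟ s
    ... | yes ≡.refl = begin
      M r zero * x₀ + S r             ≈⟨ +-congʳ (M*x₀ r) ⟩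
      - (M r zero * w) * S r + S r    ≈⟨ +-congʳ (-‿distribˡ-* _ _) ⟨
      - (M r zero * w * S r) + S r    ≈⟨ +-congʳ (-‿cong (trans (*-congʳ Mr0*w≈1) (*-identityˡ _))) ⟩
      - S r + S r                     ≈⟨ -‿inverseˡ _ ⟩
      0#                              ∎
    ... | no r≢s = ≡.subst (λ s → M s zero * x₀ + S s ≈ 0#) (Fin.punchIn-punchOut r≢s) (begin
      M s′ zero * x₀ + S s′           ≈⟨ +-comm _ _ ⟩
      S s′ + M s′ zero * x₀           ≈⟨ +-congˡ (M*x₀ s′) ⟩
      S s′ + - (M s′ zero * w) * S r  ≈⟨ sum-eliminate (M s′ ∘ suc) (M r ∘ suc) y _ ⟨
      sum (λ j → (M s′ (suc j) + - (M s′ zero * w) * M r (suc j)) * y j)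
                                      ≈⟨ sol (punchOut r≢s) ⟩
      0#                              ∎)
      where s′ = punchIn r (punchOut r≢s)

  ι-sum : ∀ {n} (t : Fin n → ℝ.Carrier) → ι (ℝ.sum t) ≈ sum (ι ∘ t)
  ι-sum {zero}  t = ι-0#
  ι-sum {suc n} t = trans (ι-+ _ _) (+-congˡ (ι-sum (t ∘ suc)))

  -- The complex scalars carry no order, so positivity means being the image of a positive real
  -- number. This treats both fields alike and makes such scalars nonzero and fixed by `conj`.
  Positive : Carrier → Set
  Positive z = ∃[ r ] ℝ.0# ℝ.≤ r × ¬ (r ℝ.≈ ℝ.0#) × z ≈ ι r

  positive-resp : ∀ {x y} → x ≈ y → Positive x → Positive y
  positive-resp x≈y (r , 0≤r , r≉0 , x≈ιr) = r , 0≤r , r≉0 , trans (sym x≈y) x≈ιr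

  positive⇒≉0 : ∀ {z} → Positive z → ¬ (z ≈ 0#)
  positive⇒≉0 (r , _ , r≉0 , z≈ιr) z≈0 =
    r≉0 (ι-injective (trans (sym z≈ιr) (trans z≈0 (sym ι-0#))))

  positive⇒conj≈ : ∀ {z} → Positive z → conj z ≈ z
  positive⇒conj≈ (r , _ , _ , z≈ιr) =
    trans (conj-cong z≈ιr) (trans (conj-ι r) (sym z≈ιr))

  positive-1 : Positive 1#
  positive-1 = ℝ.1# , ℝ.0≤1 , ℝ.1≉0 , sym ι-1#

  positive-+ : ∀ {x y} → Positive x → Positive y → Positive (x + y)
  positive-+ (r , 0≤r , r≉0 , x≈ιr) (s , 0≤s , _ , y≈ιs) =
    r ℝ.+ s , ℝ.+-nonNegative 0≤r 0≤s , r≉0 ∘ ℝ.x+y≈0⇒x≈0 0≤r 0≤s ,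
    trans (+-cong x≈ιr y≈ιs) (sym (ι-+ r s))

  positive-* : ∀ {x y} → Positive x → Positive y → Positive (x * y)
  positive-* (r , 0≤r , r≉0 , x≈ιr) (s , 0≤s , s≉0 , y≈ιs) =
    r ℝ.* s , ℝ.*-nonNegative 0≤r 0≤s , s≉0 ∘ ℝ.*-cancel-0 r≉0 ,
    trans (*-cong x≈ιr y≈ιs) (sym (ι-* r s))

  conj-neg : ∀ x → conj (- x) ≈ - conj x
  conj-neg x = begin
    conj (- x)                            ≈⟨ +-identityʳ _ ⟨
    conj (- x) + 0#                       ≈⟨ +-congˡ (-‿inverseʳ _) ⟨
    conj (- x) + (conj x + - conj x)      ≈⟨ +-assoc _ _ _ ⟨
    conj (- x) + conj x + - conj x        ≈⟨ +-congʳ (conj-+ (- x) x) ⟨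
    conj (- x + x) + - conj x             ≈⟨ +-congʳ (trans (conj-cong (-‿inverseˡ x)) conj-0#) ⟩
    0# + - conj x                         ≈⟨ +-identityˡ _ ⟩
    - conj x                              ∎

  sign : Bool → Carrier
  sign true  = 1#
  sign false = - 1#

  conj-sign : ∀ s → conj (sign s) ≈ sign s
  conj-sign true  = positive⇒conj≈ positive-1
  conj-sign false = trans (conj-neg 1#) (-‿cong (conj-sign true))

  sign*sign : ∀ s → sign s * sign s ≈ 1#
  sign*sign true  = *-identityˡ 1#
  sign*sign false = trans (sym (-‿distribˡ-* _ _))
    (trans (-‿cong (*-identityˡ _)) (-‿involutive 1#))

  sign-not : ∀ s → sign (not s) + sign s ≈ 0#
  sign-not true  = -‿inverseˡ 1#
  sign-not false = -‿inverseʳ 1#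

  HasSign : Bool → Carrier → Set
  HasSign s z = Positive (sign s * z)

  hasSign-resp : ∀ s {x y} → x ≈ y → HasSign s x → HasSign s y
  hasSign-resp s x≈y = positive-resp (*-congˡ x≈y)

  hasSign⇒≉0 : ∀ s {z} → HasSign s z → ¬ (z ≈ 0#)
  hasSign⇒≉0 s sz z≈0 = positive⇒≉0 sz (trans (*-congˡ z≈0) (zeroʳ _))

  -- Contributions of several edges to one inner product cannot cancel if they share a sign; this is
  -- the purpose of `HasSign`.
  hasSign-+ : ∀ s {x y} → HasSign s x → HasSign s y → HasSign s (x + y)
  hasSign-+ s sx sy = positive-resp (sym (distribˡ _ _ _)) (positive-+ sx sy)

-- Orthogonality and frames

module Geometry {ℝ : RealNumbers} {𝔽 : Scalars ℝ} (L : ConjugationLaws 𝔽)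
                {a ℓ : Level} (H : InnerProductSpace 𝔽 a ℓ) where
  open Scalars 𝔽 hiding (zero)
  open ConjugationLaws L
  open FieldTheory 𝔽 L
  open InnerProductSpace H
  open RingProperties ring using (-‿distribˡ-*; -1*x≈-x)
  open Sum +-commutativeMonoid using (sum; sum-cong-≋)
  open RingSolver commutativeSemiring using (solve; _:+_; _:*_; _:=_)
  open SetoidReasoning setoid
  private
    module ℝ where
      open RealNumbers ℝ public hiding (zero)
      open OrderedField ℝ public
    module Sumᴹ = Sum +ᴹ-commutativeMonoid

  -y+y≈0 : ∀ y → (- 1#) *ₗ y +ᴹ y ≈ᴹ 0ᴹ
  -y+y≈0 y = ≈ᴹ-trans (+ᴹ-congˡ (≈ᴹ-sym (*ₗ-identityˡ y)))
    (≈ᴹ-trans (≈ᴹ-sym (*ₗ-distribʳ y (- 1#) 1#))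
    (≈ᴹ-trans (*ₗ-congʳ (-‿inverseˡ 1#)) (*ₗ-zeroˡ y)))

  x-y≈0⇒x≈y : ∀ {x y} → x +ᴹ (- 1#) *ₗ y ≈ᴹ 0ᴹ → x ≈ᴹ y
  x-y≈0⇒x≈y {x} {y} eq =
    ≈ᴹ-trans (≈ᴹ-sym (+ᴹ-identityʳ x)) (≈ᴹ-trans (+ᴹ-congˡ (≈ᴹ-sym (-y+y≈0 y)))
    (≈ᴹ-trans (≈ᴹ-sym (+ᴹ-assoc x _ y)) (≈ᴹ-trans (+ᴹ-congʳ eq) (+ᴹ-identityˡ y))))

  x+y-y≈x : ∀ x y → (x +ᴹ y) +ᴹ (- 1#) *ₗ y ≈ᴹ x
  x+y-y≈x x y = ≈ᴹ-trans (+ᴹ-assoc x y _) (≈ᴹ-trans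
    (+ᴹ-congˡ (≈ᴹ-trans (+ᴹ-comm y _) (-y+y≈0 y))) (+ᴹ-identityʳ x))

  infix 4 _⊥_
  _⊥_ : Carrierᴹ → Carrierᴹ → Set
  x ⊥ y = ⟨ x , y ⟩ ≈ 0#

  ⟨⟩-congˡ : ∀ {x y y′} → y ≈ᴹ y′ → ⟨ x , y ⟩ ≈ ⟨ x , y′ ⟩
  ⟨⟩-congˡ = ⟨⟩-cong ≈ᴹ-refl

  ⟨⟩-congʳ : ∀ {x x′ y} → x ≈ᴹ x′ → ⟨ x , y ⟩ ≈ ⟨ x′ , y ⟩
  ⟨⟩-congʳ eq = ⟨⟩-cong eq ≈ᴹ-refl

  ⟨⟩-+ʳ : ∀ x y z → ⟨ x , y +ᴹ z ⟩ ≈ ⟨ x , y ⟩ + ⟨ x , z ⟩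
  ⟨⟩-+ʳ x y z = begin
    ⟨ x , y +ᴹ z ⟩                        ≈⟨ ⟨⟩-conj x (y +ᴹ z) ⟩
    conj ⟨ y +ᴹ z , x ⟩                   ≈⟨ conj-cong (⟨⟩-+ˡ y z x) ⟩
    conj (⟨ y , x ⟩ + ⟨ z , x ⟩)          ≈⟨ conj-+ _ _ ⟩
    conj ⟨ y , x ⟩ + conj ⟨ z , x ⟩       ≈⟨ +-cong (⟨⟩-conj x y) (⟨⟩-conj x z) ⟨
    ⟨ x , y ⟩ + ⟨ x , z ⟩                 ∎

  ⟨⟩-*ʳ : ∀ c x y → ⟨ x , c *ₗ y ⟩ ≈ conj c * ⟨ x , y ⟩
  ⟨⟩-*ʳ c x y = begin
    ⟨ x , c *ₗ y ⟩             ≈⟨ ⟨⟩-conj x (c *ₗ y) ⟩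
    conj ⟨ c *ₗ y , x ⟩        ≈⟨ conj-cong (⟨⟩-*ˡ c y x) ⟩
    conj (c * ⟨ y , x ⟩)       ≈⟨ conj-* c _ ⟩
    conj c * conj ⟨ y , x ⟩    ≈⟨ *-congˡ (⟨⟩-conj x y) ⟨
    conj c * ⟨ x , y ⟩         ∎

  ⊥-sym : ∀ {x y} → x ⊥ y → y ⊥ x
  ⊥-sym x⊥y = trans (⟨⟩-conj _ _) (trans (conj-cong x⊥y) conj-0#)

  ⊥-respˡ : ∀ {x x′ y} → x ≈ᴹ x′ → x ⊥ y → x′ ⊥ y
  ⊥-respˡ eq = trans (⟨⟩-congʳ (≈ᴹ-sym eq))

  ⊥-*ˡ : ∀ c {x y} → x ⊥ y → c *ₗ x ⊥ y
  ⊥-*ˡ c x⊥y = trans (⟨⟩-*ˡ c _ _) (trans (*-congˡ x⊥y) (zeroʳ c))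

  ⊥-+ˡ : ∀ {x y z} → x ⊥ z → y ⊥ z → x +ᴹ y ⊥ z
  ⊥-+ˡ x⊥z y⊥z = trans (⟨⟩-+ˡ _ _ _) (trans (+-cong x⊥z y⊥z) (+-identityˡ 0#))

  0⊥ : ∀ {x} → 0ᴹ ⊥ x
  0⊥ {x} = ⊥-respˡ (*ₗ-zeroˡ x) (trans (⟨⟩-*ˡ 0# x x) (zeroˡ _))

  ⊥-sumˡ : ∀ {n} {t : Fin n → Carrierᴹ} {y} → (∀ i → t i ⊥ y) → Sumᴹ.sum t ⊥ y
  ⊥-sumˡ {zero}  t⊥y = 0⊥
  ⊥-sumˡ {suc n} t⊥y = ⊥-+ˡ (t⊥y zero) (⊥-sumˡ (t⊥y ∘ suc))

  ⟨⟩-sumˡ : ∀ {n} (t : Fin n → Carrierᴹ) y → ⟨ Sumᴹ.sum t , y ⟩ ≈ sum (λ i → ⟨ t i , y ⟩)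
  ⟨⟩-sumˡ {zero}  t y = 0⊥
  ⟨⟩-sumˡ {suc n} t y = trans (⟨⟩-+ˡ _ _ _) (+-congˡ (⟨⟩-sumˡ (t ∘ suc) y))

  ⟨⟩-combination : ∀ {n} (c : Fin n → Carrier) e y →
    ⟨ combination c e , y ⟩ ≈ sum (λ i → c i * ⟨ e i , y ⟩)
  ⟨⟩-combination c e y = trans (⟨⟩-sumˡ (λ i → c i *ₗ e i) y)
    (sum-cong-≋ (λ i → ⟨⟩-*ˡ (c i) (e i) y))

  ⟨x,x⟩≈ι∥x∥² : ∀ x → ⟨ x , x ⟩ ≈ ι ∥ x ∥²
  ⟨x,x⟩≈ι∥x∥² x = conj-fixed (sym (⟨⟩-conj x x))

  -- Definiteness turns the question into one about scalars, whose equality is decidable.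
  -- Gram-Schmidt branches on the answer.
  _≈0? : ∀ x → Dec (x ≈ᴹ 0ᴹ)
  x ≈0? = map′ (⟨⟩-def x) (λ eq → ⊥-respˡ (≈ᴹ-sym eq) 0⊥) (⟨ x , x ⟩ ≟ 0#)

  ⟨x,x⟩-positive : ∀ {x} → ¬ (x ≈ᴹ 0ᴹ) → Positive ⟨ x , x ⟩
  ⟨x,x⟩-positive {x} x≉0 = ∥ x ∥² , ⟨⟩-nonNeg x ,
    (λ eq → x≉0 (⟨⟩-def x (trans (⟨x,x⟩≈ι∥x∥² x) (trans (ι-cong eq) ι-0#)))) ,
    ⟨x,x⟩≈ι∥x∥² x

  ⟨⟩-extensional : ∀ {x y} → (∀ z → ⟨ x , z ⟩ ≈ ⟨ y , z ⟩) → x ≈ᴹ y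
  ⟨⟩-extensional {x} {y} eq = x-y≈0⇒x≈y (⟨⟩-def _ (begin
    ⟨ d , d ⟩                          ≈⟨ trans (⟨⟩-+ˡ _ _ _) (+-congˡ (⟨⟩-*ˡ _ _ _)) ⟩
    ⟨ x , d ⟩ + - 1# * ⟨ y , d ⟩       ≈⟨ +-cong (eq d) (-1*x≈-x _) ⟩
    ⟨ y , d ⟩ + - ⟨ y , d ⟩            ≈⟨ -‿inverseʳ _ ⟩
    0#                                 ∎))
    where d = x +ᴹ (- 1#) *ₗ y

  Orthogonal Nonzero : ∀ {n} → (Fin n → Carrierᴹ) → Set _
  Orthogonal g = ∀ {i j} → i ≢ j → g i ⊥ g j
  Nonzero g = ∀ i → ¬ (g i ≈ᴹ 0ᴹ)

  -- The dual form of spanning: the orthogonal complement is zero. It can be used and proved without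
  -- coefficients.
  Total : ∀ {n} → (Fin n → Carrierᴹ) → Set (a ⊔ ℓ)
  Total g = ∀ w → (∀ i → g i ⊥ w) → w ≈ᴹ 0ᴹ

  residual : ∀ x y → ∃[ c ] x +ᴹ c *ₗ y ⊥ y
  residual x y with y ≈0?
  ... | yes y≈0 = 0# , ⊥-sym (⊥-respˡ (≈ᴹ-sym y≈0) 0⊥)
  ... | no  y≉0 with inverse _ (positive⇒≉0 (⟨x,x⟩-positive y≉0))
  ... | w , eq = - (⟨ x , y ⟩ * w) , (begin
    ⟨ x +ᴹ (- (⟨ x , y ⟩ * w)) *ₗ y , y ⟩             ≈⟨ ⟨⟩-+ˡ _ _ _ ⟩
    ⟨ x , y ⟩ + ⟨ (- (⟨ x , y ⟩ * w)) *ₗ y , y ⟩      ≈⟨ +-congˡ (⟨⟩-*ˡ _ y y) ⟩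
    ⟨ x , y ⟩ + - (⟨ x , y ⟩ * w) * ⟨ y , y ⟩         ≈⟨ +-congˡ (-‿distribˡ-* _ _) ⟨
    ⟨ x , y ⟩ + - (⟨ x , y ⟩ * w * ⟨ y , y ⟩)         ≈⟨ +-congˡ (-‿cong (begin
      ⟨ x , y ⟩ * w * ⟨ y , y ⟩                        ≈⟨ *-assoc _ _ _ ⟩
      ⟨ x , y ⟩ * (w * ⟨ y , y ⟩)                      ≈⟨ *-congˡ (trans (*-comm _ _) eq) ⟩
      ⟨ x , y ⟩ * 1#                                   ≈⟨ *-identityʳ _ ⟩
      ⟨ x , y ⟩                                        ∎)) ⟩
    ⟨ x , y ⟩ + - ⟨ x , y ⟩                           ≈⟨ -‿inverseʳ _ ⟩
    0#                                                ∎)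

  -- Congruence modulo the span of g, seen from its orthogonal complement.
  infix 4 _≡_modulo_
  _≡_modulo_ : ∀ {n} → Carrierᴹ → Carrierᴹ → (Fin n → Carrierᴹ) → Set a
  x ≡ y modulo g = ∀ w → (∀ i → g i ⊥ w) → ⟨ x , w ⟩ ≈ ⟨ y , w ⟩

  residual-modulo : ∀ x c {y w} → y ⊥ w → ⟨ x +ᴹ c *ₗ y , w ⟩ ≈ ⟨ x , w ⟩
  residual-modulo x c y⊥w =
    trans (⟨⟩-+ˡ _ _ _) (trans (+-congˡ (⊥-*ˡ c y⊥w)) (+-identityʳ _))

  -- Gram-Schmidt for an arbitrary family `g`, possibly dependent. Both `x` and `g zero` are
  -- projected off the tail of `g`, then the first result is made orthogonal to the second.
  project : ∀ {n} (g : Fin n → Carrierᴹ) x →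
    ∃[ x′ ] (∀ i → g i ⊥ x′) × x′ ≡ x modulo g
  project {zero}  g x = x , (λ ()) , λ _ _ → refl
  project {suc n} g x with project (g ∘ suc) x | project (g ∘ suc) (g zero)
  ... | x′ , g⊥x′ , x′≡x | y , g⊥y , y≡g₀ with residual x′ y
  ... | c , r⊥y = x′ +ᴹ c *ₗ y , g⊥r , r≡x
    where
    g₁⊥r : ∀ i → g (suc i) ⊥ x′ +ᴹ c *ₗ y
    g₁⊥r i = ⊥-sym (⊥-+ˡ (⊥-sym (g⊥x′ i)) (⊥-*ˡ c (⊥-sym (g⊥y i))))

    g⊥r : ∀ i → g i ⊥ x′ +ᴹ c *ₗ y
    -- The new vector is orthogonal to the tail of `g`, hence cannot distinguish `g zero` from its
    -- projection `y`.
    g⊥r zero    = trans (sym (y≡g₀ _ g₁⊥r)) (⊥-sym r⊥y)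
    g⊥r (suc i) = g₁⊥r i

    r≡x : x′ +ᴹ c *ₗ y ≡ x modulo g
    r≡x w g⊥w = trans
      (residual-modulo x′ c (trans (y≡g₀ w (g⊥w ∘ suc)) (g⊥w zero)))
      (x′≡x w (g⊥w ∘ suc))

  -- A vector whose projection vanishes depends on the later ones and is dropped, so `k` may be
  -- smaller than `d`. The last component says in dual form that `e` lies in the span of `g`.
  orthogonalise : ∀ {d} (e : Fin d → Carrierᴹ) →
    ∃[ k ] k ℕ.≤ d × (Σ[ g ∈ (Fin k → Carrierᴹ) ]
      Orthogonal g × Nonzero g × (∀ w → (∀ i → g i ⊥ w) → ∀ i → e i ⊥ w))
  orthogonalise {zero}  e = 0 , z≤n , (λ ()) , (λ { {()} }) , (λ ()) , λ _ _ ()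
  orthogonalise {suc d} e with orthogonalise (e ∘ suc)
  ... | k , k≤d , g , orth , g≉0 , g-covers with project g (e zero)
  ... | y , g⊥y , y≡e₀ with y ≈0?
  ... | yes y≈0 = k , ℕ.m≤n⇒m≤1+n k≤d , g , orth , g≉0 , λ
    { w g⊥w zero    → trans (sym (y≡e₀ w g⊥w)) (⊥-respˡ (≈ᴹ-sym y≈0) 0⊥)
    ; w g⊥w (suc i) → g-covers w g⊥w i
    }
  ... | no y≉0 = suc k , s≤s k≤d , y Vector.∷ g , orth′ , nonzero′ , λ
    { w yg⊥w zero    → trans (sym (y≡e₀ w (yg⊥w ∘ suc))) (yg⊥w zero)
    ; w yg⊥w (suc i) → g-covers w (yg⊥w ∘ suc) i
    }
    where
    orth′ : Orthogonal (y Vector.∷ g)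
    orth′ {zero}  {zero}  i≢j = contradiction ≡.refl i≢j
    orth′ {zero}  {suc j} i≢j = ⊥-sym (g⊥y j)
    orth′ {suc i} {zero}  i≢j = g⊥y i
    orth′ {suc i} {suc j} i≢j = orth (i≢j ∘ ≡.cong suc)

    nonzero′ : Nonzero (y Vector.∷ g)
    nonzero′ zero    = y≉0
    nonzero′ (suc i) = g≉0 i

  combination⊥ : ∀ {N d} → N ℕ.< d → (e : Fin d → Carrierᴹ) (g : Fin N → Carrierᴹ) →
    Σ[ c ∈ (Fin d → Carrier) ] (∃[ i ] ¬ (c i ≈ 0#)) × (∀ r → combination c e ⊥ g r)
  combination⊥ {d = d} N<d e g with kernel N<d (λ r j → ⟨ e j , g r ⟩)
  ... | c , c≉0 , sol = c , c≉0 , λ r →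
    trans (⟨⟩-combination c e (g r)) (trans (sum-cong-≋ {d} (λ j → *-comm (c j) ⟨ e j , g r ⟩)) (sol r))

  -- With fewer than `d` test vectors some nontrivial combination of `e` is orthogonal to all of
  -- them, hence zero. This takes the place of the exchange lemma.
  independent⇒≤total : ∀ {N d} {e : Fin d → Carrierᴹ} {g : Fin N → Carrierᴹ} →
    LinearlyIndependent e → Total g → d ℕ.≤ N
  independent⇒≤total {N} {d} {e} {g} indep total = ℕ.≮⇒≥ λ N<d →
    let (c , (i , ci≉0) , c⊥g) = combination⊥ N<d e g in
    ci≉0 (indep c (total _ (λ r → ⊥-sym (c⊥g r))) i)

  spanning⇒total : ∀ {d} {e : Fin d → Carrierᴹ} → Spanning e → Total e
  spanning⇒total {e = e} span w e⊥w = let (c , w≈ce) = span w in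
    ⟨⟩-def w (⊥-respˡ (≈ᴹ-sym w≈ce) (⊥-sumˡ (λ i → ⊥-*ˡ (c i) (e⊥w i))))

  -- Gram-Schmidt loses no vector here, because a total family has at least `d` members.
  orthogonalBasis : ∀ {d} → HasDimension d →
    Σ[ g ∈ (Fin d → Carrierᴹ) ] Orthogonal g × Nonzero g × Total g
  orthogonalBasis (e , indep , span) with orthogonalise e
  ... | k , k≤d , g , orth , g≉0 , covers =
    ≡.subst (λ d → Σ[ g ∈ (Fin d → Carrierᴹ) ] Orthogonal g × Nonzero g × Total g)
      (ℕ.≤-antisym k≤d (independent⇒≤total indep total)) (g , orth , g≉0 , total)
    where
    total : Total g
    total w g⊥w = spanning⇒total span w (covers w g⊥w)

  -- The difference of the two sides is the product of the squared norms of `x` and of the residual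
  -- `r` of `f` along `x`.
  cauchySchwarz : ∀ f x → ∣ ⟨ f , x ⟩ ∣² ℝ.≤ ∥ x ∥² ℝ.* ∥ f ∥²
  cauchySchwarz f x with residual f x
  ... | c , r⊥x = ℝ.≤-resp ℝ.refl eq
    (ℝ.≤+nonNegative (ℝ.*-nonNegative (⟨⟩-nonNeg x) (⟨⟩-nonNeg r)))
    where
    r : Carrierᴹ
    r = f +ᴹ c *ₗ x

    ⟨r,r⟩ : ⟨ r , r ⟩ ≈ ⟨ f , f ⟩ + c * ⟨ x , f ⟩
    ⟨r,r⟩ = begin
      ⟨ r , r ⟩                              ≈⟨ ⟨⟩-+ʳ r f (c *ₗ x) ⟩
      ⟨ r , f ⟩ + ⟨ r , c *ₗ x ⟩             ≈⟨ +-congˡ (⊥-sym (⊥-*ˡ c (⊥-sym r⊥x))) ⟩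
      ⟨ r , f ⟩ + 0#                         ≈⟨ +-identityʳ _ ⟩
      ⟨ r , f ⟩                              ≈⟨ trans (⟨⟩-+ˡ f _ f) (+-congˡ (⟨⟩-*ˡ c x f)) ⟩
      ⟨ f , f ⟩ + c * ⟨ x , f ⟩              ∎

    ⟨f,x⟩ : ⟨ f , x ⟩ + c * ⟨ x , x ⟩ ≈ 0#
    ⟨f,x⟩ = trans (sym (trans (⟨⟩-+ˡ f _ x) (+-congˡ (⟨⟩-*ˡ c x x)))) r⊥x

    eq : ∣ ⟨ f , x ⟩ ∣² ℝ.+ ∥ x ∥² ℝ.* ∥ r ∥² ℝ.≈ ∥ x ∥² ℝ.* ∥ f ∥²
    eq = ι-injective (begin
      ι (∣ ⟨ f , x ⟩ ∣² ℝ.+ ∥ x ∥² ℝ.* ∥ r ∥²)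
        ≈⟨ trans (ι-+ _ _) (+-congˡ (ι-* _ _)) ⟩
      ι ∣ ⟨ f , x ⟩ ∣² + ι ∥ x ∥² * ι ∥ r ∥²
        ≈⟨ +-cong (trans (sym (z*conj≈ι∣z∣² _)) (*-congˡ (sym (⟨⟩-conj x f))))
                  (*-cong (sym (⟨x,x⟩≈ι∥x∥² x)) (trans (sym (⟨x,x⟩≈ι∥x∥² r)) ⟨r,r⟩)) ⟩
      ⟨ f , x ⟩ * ⟨ x , f ⟩ + ⟨ x , x ⟩ * (⟨ f , f ⟩ + c * ⟨ x , f ⟩)
        ≈⟨ solve 5 (λ fx xf xx ff c → fx :* xf :+ xx :* (ff :+ c :* xf) :=
             xx :* ff :+ (fx :+ c :* xx) :* xf)
             refl ⟨ f , x ⟩ ⟨ x , f ⟩ ⟨ x , x ⟩ ⟨ f , f ⟩ c ⟩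
      ⟨ x , x ⟩ * ⟨ f , f ⟩ + (⟨ f , x ⟩ + c * ⟨ x , x ⟩) * ⟨ x , f ⟩
        ≈⟨ +-congˡ (trans (*-congʳ ⟨f,x⟩) (zeroˡ _)) ⟩
      ⟨ x , x ⟩ * ⟨ f , f ⟩ + 0#
        ≈⟨ +-identityʳ _ ⟩
      ⟨ x , x ⟩ * ⟨ f , f ⟩
        ≈⟨ *-cong (⟨x,x⟩≈ι∥x∥² x) (⟨x,x⟩≈ι∥x∥² f) ⟩
      ι ∥ x ∥² * ι ∥ f ∥²
        ≈⟨ ι-* _ _ ⟨
      ι (∥ x ∥² ℝ.* ∥ f ∥²)  ∎)

  -- Frame bounds

  record IsSubspace (P : Carrierᴹ → Set a) : Set (a ⊔ ℓ) where
    field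
      resp     : ∀ {x y} → x ≈ᴹ y → P x → P y
      +-closed : ∀ {x y} → P x → P y → P (x +ᴹ y)
      *-closed : ∀ c {x} → P x → P (c *ₗ x)
      0-closed : P 0ᴹ

    sum-closed : ∀ {n} {t : Fin n → Carrierᴹ} → (∀ i → P (t i)) → P (Sumᴹ.sum t)
    sum-closed {zero}  Pt = 0-closed
    sum-closed {suc n} Pt = +-closed (Pt zero) (sum-closed (Pt ∘ suc))

  module _ (Q : Carrierᴹ → ℝ.Carrier) where
    -- With `Q f` the frame sum of `f`, these vectors form a subspace containing the frame, hence
    -- its whole span. The bound `K` must be uniform in `f`.
    Dominated : Carrierᴹ → Set a
    Dominated x = ∃[ K ] ℝ.0# ℝ.≤ K × (∀ f → ∣ ⟨ f , x ⟩ ∣² ℝ.≤ K ℝ.* Q f)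

    dominated-isSubspace : IsSubspace Dominated
    dominated-isSubspace = record
      { resp     = λ x≈y (K , 0≤K , bound) → K , 0≤K , λ f →
          ℝ.≤-resp (∣∣²-cong (⟨⟩-congˡ x≈y)) ℝ.refl (bound f)
      ; +-closed = λ {x} {y} (K , 0≤K , bound) (K′ , 0≤K′ , bound′) →
          (ℝ.1# ℝ.+ ℝ.1#) ℝ.* (K ℝ.+ K′) ,
          ℝ.*-nonNegative ℝ.0≤2 (ℝ.+-nonNegative 0≤K 0≤K′) , λ f →
          ℝ.≤-resp (∣∣²-cong (sym (⟨⟩-+ʳ f x y)))
            (ℝ.trans (ℝ.*-congˡ (ℝ.sym (ℝ.distribʳ _ _ _))) (ℝ.sym (ℝ.*-assoc _ _ _)))
            (ℝ.≤.trans (∣∣²-+-≤ _ _)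
              (ℝ.*-monoˡ-≤ ℝ.0≤2 (ℝ.+-mono-≤ (bound f) (bound′ f))))
      ; *-closed = λ c {x} (K , 0≤K , bound) →
          ∣ conj c ∣² ℝ.* K , ℝ.*-nonNegative (∣∣²-nonNegative _) 0≤K , λ f →
          ℝ.≤-resp
            (ℝ.trans (ℝ.sym (∣∣²-* _ _)) (∣∣²-cong (sym (⟨⟩-*ʳ c f x))))
            (ℝ.sym (ℝ.*-assoc _ _ _))
            (ℝ.*-monoˡ-≤ (∣∣²-nonNegative (conj c)) (bound f))
      ; 0-closed = ℝ.0# , ℝ.≤.refl , λ f →
          ℝ.≤.reflexive (ℝ.trans (ℝ.trans (∣∣²-cong (⊥-sym 0⊥)) ∣0∣²) (ℝ.sym (ℝ.zeroˡ _)))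
      }

  -- Totality kills the difference between `f` and its expansion `p`. The `g k` are not normalised,
  -- so the inverses of their squared norms enter as the weights `v`.
  parseval : ∀ {d} {g : Fin d → Carrierᴹ} → Orthogonal g → Nonzero g → Total g →
    Σ[ v ∈ (Fin d → ℝ.Carrier) ] (∀ k → ℝ.0# ℝ.≤ v k) ×
      (∀ f → ∥ f ∥² ℝ.≈ ℝ.sum (λ k → v k ℝ.* ∣ ⟨ f , g k ⟩ ∣²))
  parseval {d} {g} orth g≉0 total = v , v≥0 , norm
    where
    inv : ∀ k → ∃[ s ] ℝ.0# ℝ.≤ s × ι s * ⟨ g k , g k ⟩ ≈ 1#
    inv k with ⟨x,x⟩-positive (g≉0 k)
    ... | r , 0≤r , r≉0 , eq with ℝ.inverse r r≉0
    ... | s , rs≈1 = s , ℝ.nonNegative-inverse 0≤r rs≈1 , (begin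
      ι s * ⟨ g k , g k ⟩   ≈⟨ trans (*-comm _ _) (*-congʳ eq) ⟩
      ι r * ι s             ≈⟨ ι-* r s ⟨
      ι (r ℝ.* s)           ≈⟨ trans (ι-cong rs≈1) ι-1# ⟩
      1#                    ∎)

    v = proj₁ ∘ inv
    v≥0 = λ k → proj₁ (proj₂ (inv k))

    module _ (f : Carrierᴹ) where
      c : Fin d → Carrier
      c k = ⟨ f , g k ⟩ * ι (v k)

      p : Carrierᴹ
      p = combination c g

      ⟨p,g⟩ : ∀ k → ⟨ p , g k ⟩ ≈ ⟨ f , g k ⟩
      ⟨p,g⟩ k = begin
        ⟨ p , g k ⟩                                ≈⟨ ⟨⟩-combination c g (g k) ⟩
        sum (λ i → c i * ⟨ g i , g k ⟩)            ≈⟨ sum-single k (λ i i≢k →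
                                                        trans (*-congˡ (orth i≢k)) (zeroʳ (c i))) ⟩
        c k * ⟨ g k , g k ⟩                        ≈⟨ *-assoc _ _ _ ⟩
        ⟨ f , g k ⟩ * (ι (v k) * ⟨ g k , g k ⟩)    ≈⟨ *-congˡ (proj₂ (proj₂ (inv k))) ⟩
        ⟨ f , g k ⟩ * 1#                           ≈⟨ *-identityʳ _ ⟩
        ⟨ f , g k ⟩                                ∎

      difference : Carrierᴹ
      difference = f +ᴹ (- 1#) *ₗ p

      difference≈0 : difference ≈ᴹ 0ᴹ
      difference≈0 = total difference λ k → ⊥-sym (begin
        ⟨ difference , g k ⟩                       ≈⟨ trans (⟨⟩-+ˡ _ _ _) (+-congˡ (⟨⟩-*ˡ _ _ _)) ⟩
        ⟨ f , g k ⟩ + - 1# * ⟨ p , g k ⟩           ≈⟨ +-congˡ (trans (-1*x≈-x _) (-‿cong (⟨p,g⟩ k))) ⟩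
        ⟨ f , g k ⟩ + - ⟨ f , g k ⟩                ≈⟨ -‿inverseʳ _ ⟩
        0#                                         ∎)

      f≈p : f ≈ᴹ p
      f≈p = x-y≈0⇒x≈y difference≈0

      norm : ∥ f ∥² ℝ.≈ ℝ.sum (λ k → v k ℝ.* ∣ ⟨ f , g k ⟩ ∣²)
      norm = ι-injective (begin
        ι ∥ f ∥²                                      ≈⟨ ⟨x,x⟩≈ι∥x∥² f ⟨
        ⟨ f , f ⟩                                     ≈⟨ ⟨⟩-congʳ f≈p ⟩
        ⟨ p , f ⟩                                     ≈⟨ ⟨⟩-combination c g f ⟩
        sum (λ k → c k * ⟨ g k , f ⟩)                 ≈⟨ sum-cong-≋ {d} term ⟩
        sum (λ k → ι (v k ℝ.* ∣ ⟨ f , g k ⟩ ∣²))      ≈⟨ ι-sum (λ k → v k ℝ.* ∣ ⟨ f , g k ⟩ ∣²) ⟨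
        ι (ℝ.sum (λ k → v k ℝ.* ∣ ⟨ f , g k ⟩ ∣²))    ∎)
        where
        term : ∀ k → c k * ⟨ g k , f ⟩ ≈ ι (v k ℝ.* ∣ ⟨ f , g k ⟩ ∣²)
        term k = begin
          ⟨ f , g k ⟩ * ι (v k) * ⟨ g k , f ⟩             ≈⟨ *-cong (*-comm _ _) (⟨⟩-conj (g k) f) ⟩
          ι (v k) * ⟨ f , g k ⟩ * conj ⟨ f , g k ⟩        ≈⟨ *-assoc _ _ _ ⟩
          ι (v k) * (⟨ f , g k ⟩ * conj ⟨ f , g k ⟩)      ≈⟨ *-congˡ (z*conj≈ι∣z∣² _) ⟩
          ι (v k) * ι ∣ ⟨ f , g k ⟩ ∣²                    ≈⟨ ι-* _ _ ⟨
          ι (v k ℝ.* ∣ ⟨ f , g k ⟩ ∣²)                    ∎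

  -- The last hypothesis puts each `g k` into the span of `φ`, understood as the intersection of all
  -- subspaces containing `φ`. Taking `Dominated Q` for `P` and summing by Parseval gives the lower
  -- bound; the upper one is Cauchy-Schwarz.
  isFrame : ∀ {N d} {φ : Fin N → Carrierᴹ} {g : Fin d → Carrierᴹ} →
    Orthogonal g → Nonzero g → Total g →
    (∀ P → IsSubspace P → (∀ i → P (φ i)) → ∀ k → P (g k)) → IsFrame φ
  isFrame {N} {d} {φ} {g} orth g≉0 total covers =
    -- `B` alone is an upper bound; `A` is added to make the two constants comparable.
    A , A ℝ.+ B , (0≤A , A≉0 ∘ ℝ.sym) , ℝ.≤+nonNegative 0≤B , λ f → lower f , upper f
    where
    Q : Carrierᴹ → ℝ.Carrier
    Q f = ℝ.sum (λ i → ∣ ⟨ f , φ i ⟩ ∣²)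

    Q≥0 : ∀ f → ℝ.0# ℝ.≤ Q f
    Q≥0 f = ℝ.sum-nonNegative {N} (λ i → ∣∣²-nonNegative _)

    dominated : ∀ k → Dominated Q (g k)
    dominated = covers (Dominated Q) (dominated-isSubspace Q) λ i →
      ℝ.1# , ℝ.0≤1 , λ f → ℝ.≤-resp ℝ.refl (ℝ.sym (ℝ.*-identityˡ _))
        (ℝ.term≤sum (λ i → ∣∣²-nonNegative ⟨ f , φ i ⟩) i)

    v = proj₁ (parseval orth g≉0 total)
    v≥0 = proj₁ (proj₂ (parseval orth g≉0 total))
    norm = proj₂ (proj₂ (parseval orth g≉0 total))

    C = ℝ.sum (λ k → v k ℝ.* proj₁ (dominated k))

    0≤C : ℝ.0# ℝ.≤ C
    0≤C = ℝ.sum-nonNegative {d} (λ k → ℝ.*-nonNegative (v≥0 k) (proj₁ (proj₂ (dominated k))))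

    ∥f∥²≤CQ : ∀ f → ∥ f ∥² ℝ.≤ C ℝ.* Q f
    ∥f∥²≤CQ f = ℝ.≤-resp (ℝ.sym (norm f))
      (ℝ.sym (ℝ.*-distribʳ-sum (Q f) (λ k → v k ℝ.* proj₁ (dominated k))))
      (ℝ.sum-mono-≤ {d} (λ k → ℝ.≤-resp ℝ.refl (ℝ.sym (ℝ.*-assoc (v k) _ _))
        (ℝ.*-monoˡ-≤ (v≥0 k) (proj₂ (proj₂ (dominated k)) f))))

    -- Inverting `1 + C` instead of `C` avoids a separate case for `C` zero.
    C+1≉0 : ¬ (ℝ.1# ℝ.+ C ℝ.≈ ℝ.0#)
    C+1≉0 = ℝ.1≉0 ∘ ℝ.x+y≈0⇒x≈0 ℝ.0≤1 0≤C

    A = proj₁ (ℝ.inverse _ C+1≉0)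
    CA≈1 = proj₂ (ℝ.inverse _ C+1≉0)

    0≤A : ℝ.0# ℝ.≤ A
    0≤A = ℝ.nonNegative-inverse (ℝ.+-nonNegative ℝ.0≤1 0≤C) CA≈1

    A≉0 : ¬ (A ℝ.≈ ℝ.0#)
    A≉0 A≈0 = ℝ.1≉0 (ℝ.trans (ℝ.sym CA≈1) (ℝ.trans (ℝ.*-congˡ A≈0) (ℝ.zeroʳ _)))

    lower : ∀ f → A ℝ.* ∥ f ∥² ℝ.≤ Q f
    lower f = ℝ.≤.trans
      (ℝ.*-monoˡ-≤ 0≤A (ℝ.≤.trans (∥f∥²≤CQ f)
        (ℝ.≤-resp ℝ.refl (ℝ.trans (ℝ.+-comm _ _) (ℝ.sym (ℝ.distribʳ (Q f) ℝ.1# C)))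
          (ℝ.≤+nonNegative (ℝ.*-nonNegative ℝ.0≤1 (Q≥0 f))))))
      (ℝ.≤.reflexive (ℝ.trans (ℝ.sym (ℝ.*-assoc _ _ _))
        (ℝ.trans (ℝ.*-congʳ (ℝ.trans (ℝ.*-comm _ _) CA≈1)) (ℝ.*-identityˡ _))))

    B = ℝ.sum (λ i → ∥ φ i ∥²)

    0≤B : ℝ.0# ℝ.≤ B
    0≤B = ℝ.sum-nonNegative {N} (λ i → ⟨⟩-nonNeg (φ i))

    upper : ∀ f → Q f ℝ.≤ (A ℝ.+ B) ℝ.* ∥ f ∥²
    upper f = ℝ.≤.trans
      (ℝ.≤-resp ℝ.refl (ℝ.sym (ℝ.*-distribʳ-sum ∥ f ∥² (λ i → ∥ φ i ∥²)))
        (ℝ.sum-mono-≤ {N} (λ i → cauchySchwarz f (φ i))))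
      (ℝ.≤-resp ℝ.refl (ℝ.trans (ℝ.+-comm _ _) (ℝ.sym (ℝ.distribʳ ∥ f ∥² A B)))
        (ℝ.≤+nonNegative (ℝ.*-nonNegative 0≤A (⟨⟩-nonNeg f))))

  frame⇒total : ∀ {N} {φ : Fin N → Carrierᴹ} → IsFrame φ → Total φ
  frame⇒total {N} {φ} (A , B , (0≤A , 0≉A) , _ , bounds) w φ⊥w =
    ⟨⟩-def w (trans (⟨x,x⟩≈ι∥x∥² w) (trans (ι-cong ∥w∥²≈0) ι-0#))
    where
    Q≈0 : ℝ.sum (λ i → ∣ ⟨ w , φ i ⟩ ∣²) ℝ.≈ ℝ.0#
    Q≈0 = ℝ.sum-zero {N} (λ i → ℝ.trans (∣∣²-cong (⊥-sym (φ⊥w i))) ∣0∣²)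

    ∥w∥²≈0 : ∥ w ∥² ℝ.≈ ℝ.0#
    ∥w∥²≈0 = ℝ.*-cancel-0 (0≉A ∘ ℝ.sym) (ℝ.≤.antisym
      (ℝ.≤-resp ℝ.refl Q≈0 (proj₁ (bounds w)))
      (ℝ.*-nonNegative 0≤A (⟨⟩-nonNeg w)))

-- Trees

comap : {V W : Set} → (W → V) → SimpleGraph V → SimpleGraph W
comap f G = record
  { _~_       = λ u v → f u ~ f v
  ; symmetric = symmetric
  ; loopless  = loopless
  ; adjacent? = λ u v → adjacent? (f u) (f v)
  }
  where open SimpleGraph G

-- An order of dismantling: `zero` is a leaf with the only neighbour `suc p`, and `comap suc G` is
-- the rest. Both directions of the theorem recurse on it; the vertex left at the end is the root.
data LeafOrder : ∀ {k} → SimpleGraph (Fin k) → Set₁ where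
  single : {G : SimpleGraph (Fin 1)} → LeafOrder G
  leaf   : ∀ {k} {G : SimpleGraph (Fin (suc k))} → let open SimpleGraph G in
           LeafOrder (comap suc G) → (p : Fin k) → zero ~ suc p →
           (∀ q → zero ~ suc q → q ≡ p) → LeafOrder G

root : ∀ {k} {G : SimpleGraph (Fin k)} → LeafOrder G → Fin k
root single           = zero
root (leaf order _ _ _) = suc (root order)

module _ {n : ℕ} (G : SimpleGraph (Fin n)) where
  open SimpleGraph G
  open DecMembership (Fin._≟_ {n}) using (_∈?_)

  dropUntil : ∀ {u v x} (p : Walk G u v) → IsPath G p → x ∈ vertices G p →
    Σ[ q ∈ Walk G x v ] IsPath G q × vertices G q ⊆ vertices G p
  dropUntil []      path       (here ≡.refl) = [] , path , id
  dropUntil (e ∷ p) path       (here ≡.refl) = e ∷ p , path , id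
  dropUntil (e ∷ p) (_ ∷ path) (there x∈p)   =
    let (q , path′ , q⊆p) = dropUntil p path x∈p in q , path′ , there ∘ q⊆p

  -- The inclusion of vertices matters: a path through visited vertices must not leave them when it
  -- is shortened.
  eraseLoops : ∀ {u v} (w : Walk G u v) →
    Σ[ p ∈ Walk G u v ] IsPath G p × vertices G p ⊆ vertices G w
  eraseLoops []            = [] , [] ∷ [] , id
  eraseLoops {u} (u~x ∷ w) with eraseLoops w
  ... | p , path , p⊆w with u ∈? vertices G p
  ... | yes u∈p = let (q , path′ , q⊆p) = dropUntil p path u∈p in q , path′ , there ∘ p⊆w ∘ q⊆p
  ... | no  u∉p = u~x ∷ p , All.¬Any⇒All¬ _ u∉p ∷ path ,
    λ { (here eq) → here eq ; (there y∈p) → there (p⊆w y∈p) }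

  module _ {k : ℕ} (π : Fin k → Fin n) where
    Visited : Fin n → Set
    Visited v = ∃[ i ] π i ≡ v

    visited? : ∀ v → Dec (Visited v)
    visited? v = Fin.any? (λ i → π i Fin.≟ v)

    VisitedWalk : Fin n → Fin n → Set
    VisitedWalk u v = Σ[ w ∈ Walk G u v ] All Visited (vertices G w)

    -- The first edge of the walk that leaves the visited set; its far end becomes the next leaf.
    exit : ∀ {u v} → Walk G u v → Visited u → ¬ Visited v →
      ∃[ i ] ∃[ x ] π i ~ x × ¬ Visited x
    exit []                 seen-u unseen-v = contradiction seen-u unseen-v
    exit (_∷_ {v = x} u~x w) (i , ≡.refl) unseen-v with visited? x
    ... | yes seen-x = exit w seen-x unseen-v
    ... | no unseen-x = i , x , u~x , unseen-x

    snoc : ∀ {u v x} → VisitedWalk u v → v ~ x → Visited x → VisitedWalk u x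
    snoc ([]    , seen ∷ [])    v~x seen-x = v~x ∷ [] , seen ∷ seen-x ∷ []
    snoc (e ∷ w , seen ∷ seens) v~x seen-x =
      let (w′ , seens′) = snoc (w , seens) v~x seen-x in e ∷ w′ , seen ∷ seens′

    -- Two visited neighbours of `x` are joined by a path of visited vertices, which avoids `x` and
    -- so closes up to a cycle through it.
    unique-neighbour : ¬ HasCycle G → Injective _≡_ _≡_ π → (∀ i j → VisitedWalk (π i) (π j)) →
      ∀ {x} → ¬ Visited x → ∀ {i j} → x ~ π i → x ~ π j → j ≡ i
    unique-neighbour acyclic injective connected {x} unseen-x {i} {j} x~i x~j =
      decidable-stable (j Fin.≟ i) λ j≢i → acyclic (cycle j≢i)
      where
      cycle : j ≢ i → HasCycle G
      cycle j≢i with connected i j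
      ... | w , seens with eraseLoops w
      ... | p , path , p⊆w = π j , x , symmetric x~j , x~i ∷ p ,
        All.tabulate (λ y∈p x≡y → unseen-x
          (≡.subst Visited (≡.sym x≡y) (All.lookup seens (p⊆w y∈p)))) ∷ path ,
        s≤s (nontrivial p ≡.refl)
        where
        -- The endpoint is generalised so that the empty walk can be matched. Together with the edge
        -- from `x` this gives length two.
        nontrivial : ∀ {v} (p : Walk G (π i) v) → v ≡ π j → 1 ℕ.≤ length G p
        nontrivial []      eq = contradiction (≡.sym (injective eq)) j≢i
        nontrivial (_ ∷ _) _  = s≤s z≤n

  visitedWalk-weaken : ∀ {k x} {π : Fin k → Fin n} {u v} →
    VisitedWalk π u v → VisitedWalk (x Vector.∷ π) u v
  visitedWalk-weaken (w , seens) = w , All.map (λ (i , eq) → suc i , eq) seens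

  -- A subtree with its vertices numbered from the most recent one back to the starting vertex.
  -- `connected` is kept for the cycle argument at the next step.
  record PartialLeafOrder (k : ℕ) : Set₁ where
    field
      π         : Fin k → Fin n
      injective : Injective _≡_ _≡_ π
      order     : LeafOrder (comap π G)
      connected : ∀ i j → VisitedWalk π (π i) (π j)

  start : Fin n → PartialLeafOrder 1
  start r = record
    { π         = λ _ → r
    ; injective = λ { {zero} {zero} _ → ≡.refl }
    ; order     = single
    ; connected = λ _ _ → [] , (zero , ≡.refl) ∷ []
    }

  module _ (isTree : IsTree G) where
    grow : ∀ {k} (p : PartialLeafOrder (suc k)) {x} →
      ¬ Visited (PartialLeafOrder.π p) x → PartialLeafOrder (suc (suc k))
    grow {k} p {v} unseen-v with exit π (proj₁ isTree (π zero) v) (zero , ≡.refl) unseen-v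
      where open PartialLeafOrder p
    ... | i , x , i~x , unseen-x = record
      { π         = x Vector.∷ π
      ; injective = injective′ _ _
      ; order     = leaf order i (symmetric i~x) λ j x~j →
          unique-neighbour π (proj₂ isTree) injective connected unseen-x (symmetric i~x) x~j
      ; connected = connected′
      }
      where
      open PartialLeafOrder p

      injective′ : ∀ i j → (x Vector.∷ π) i ≡ (x Vector.∷ π) j → i ≡ j
      injective′ zero    zero    eq = ≡.refl
      injective′ zero    (suc j) eq = contradiction (j , ≡.sym eq) unseen-x
      injective′ (suc i) zero    eq = contradiction (i , eq) unseen-x
      injective′ (suc i) (suc j) eq = ≡.cong suc (injective eq)

      connected′ : ∀ i j → VisitedWalk (x Vector.∷ π) ((x Vector.∷ π) i) ((x Vector.∷ π) j)
      connected′ zero    zero    = [] , (zero , ≡.refl) ∷ []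
      connected′ zero    (suc j) = let (w , seens) = visitedWalk-weaken (connected i j) in
        symmetric i~x ∷ w , (zero , ≡.refl) ∷ seens
      connected′ (suc j) zero    =
        snoc _ (visitedWalk-weaken (connected j i)) i~x (zero , ≡.refl)
      connected′ (suc j) (suc l) = visitedWalk-weaken (connected j l)

    -- `g` bounds the number of unvisited vertices. When it is zero, a further vertex would embed
    -- `k + 2` indices into at most `k + 1` vertices.
    exhaust : ∀ {k} g → PartialLeafOrder (suc k) → n ℕ.≤ suc k ℕ.+ g →
      ∃[ k ] Σ[ p ∈ PartialLeafOrder k ] (∀ v → Visited (PartialLeafOrder.π p) v)
    exhaust g p n≤ with Fin.all? (visited? (PartialLeafOrder.π p))
    ... | yes all-seen = _ , p , all-seen
    ... | no ¬all-seen with Fin.¬∀⟶∃¬ n _ (visited? (PartialLeafOrder.π p)) ¬all-seen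
    exhaust zero p n≤ | no _ | v , unseen-v =
      contradiction (Fin.injective⇒≤ (PartialLeafOrder.injective (grow p unseen-v)))
        (ℕ.<⇒≱ (s≤s (ℕ.≤-trans n≤ (ℕ.≤-reflexive (ℕ.+-identityʳ _)))))
    exhaust (suc g) p n≤ | no _ | v , unseen-v =
      exhaust g (grow p unseen-v) (ℕ.≤-trans n≤ (ℕ.≤-reflexive (ℕ.+-suc _ g)))

    treeLeafOrder : 1 ℕ.≤ n →
      Σ[ π ∈ (Fin n → Fin n) ] Injective _≡_ _≡_ π × LeafOrder (comap π G) × (∀ v → ∃[ i ] π i ≡ v)
    treeLeafOrder 1≤n with exhaust n (start (fromℕ< 1≤n)) (ℕ.n≤1+n n)
    -- `π` is injective and so is the choice of preimages, whence `k` equals `n`.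
    ... | k , p , all-seen with ℕ.≤-antisym (Fin.injective⇒≤ injective)
                                  (Fin.injective⇒≤ (λ {u} {v} eq → ≡.trans (≡.sym (proj₂ (all-seen u)))
                                    (≡.trans (≡.cong π eq) (proj₂ (all-seen v)))))
      where open PartialLeafOrder p
    ... | ≡.refl = π , injective , order , all-seen
      where open PartialLeafOrder p

-- The lower bound

module LowerBound {ℝ : RealNumbers} {𝔽 : Scalars ℝ} (L : ConjugationLaws 𝔽)
                  {a ℓ : Level} (H : InnerProductSpace 𝔽 a ℓ) where
  open Scalars 𝔽 hiding (zero)
  open FieldTheory 𝔽 L
  open InnerProductSpace H
  open Geometry L H
  open Sum +-commutativeMonoid using (sum; sum-cong-≋)
  open SetoidReasoning setoid
  private module Sumᴹ = Sum +ᴹ-commutativeMonoid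

  -- The adjacencies of G □ K_m between different copies of K_m.
  record Represents {k m} (G : SimpleGraph (Fin k)) (f : Fin k → Fin m → Carrierᴹ) : Set where
    open SimpleGraph G
    field
      nonadjacent : ∀ {u v i j} → u ≢ v → ¬ (u ~ v × i ≡ j) → f u i ⊥ f v j
      adjacent    : ∀ {u v i} → u ~ v → ¬ (f u i ⊥ f v i)

  combination₂ : ∀ {k m} → (Fin k → Fin m → Carrier) → (Fin k → Fin m → Carrierᴹ) → Carrierᴹ
  combination₂ x f = Sumᴹ.sum (λ u → combination (x u) (f u))

  combination₂-⊥ : ∀ {k m} (x : Fin k → Fin m → Carrier) {f : Fin k → Fin m → Carrierᴹ} {w} →
    (∀ u i → x u i *ₗ f u i ⊥ w) → combination₂ x f ⊥ w
  combination₂-⊥ x f⊥w = ⊥-sumˡ λ u → ⊥-sumˡ (f⊥w u)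

  ⟨⟩-combination₂ : ∀ {k m} (x : Fin k → Fin m → Carrier) f w →
    ⟨ combination₂ x f , w ⟩ ≈ sum (λ u → sum (λ i → x u i * ⟨ f u i , w ⟩))
  ⟨⟩-combination₂ {k} x f w = trans (⟨⟩-sumˡ (λ u → combination (x u) (f u)) w)
    (sum-cong-≋ {k} (λ u → ⟨⟩-combination (x u) (f u) w))

  -- `Represents` speaks only of different copies, so the projected family `g` inherits it, although
  -- inner products inside the copy at `p` may change.
  vanishing : ∀ {k m} {G : SimpleGraph (Fin k)} (order : LeafOrder G)
    {f : Fin k → Fin m → Carrierᴹ} → Represents G f → (x : Fin k → Fin m → Carrier) →
    (∀ j → x (root order) j ≈ 0#) → combination₂ x f ≈ᴹ 0ᴹ → ∀ u j → x u j ≈ 0#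
  vanishing single f-rep x x-root≈0 _ zero = x-root≈0
  vanishing {suc k} {m} {G} (leaf order p 0~p only-p) {f} f-rep x x-root≈0 xf≈0 = λ
    { zero    → x₀≈0
    ; (suc u) → xₛ≈0 u
    }
    where
    open Represents f-rep

    g : Fin k → Fin m → Carrierᴹ
    g u i = proj₁ (project (f zero) (f (suc u) i))

    f₀⊥g : ∀ {j} u i → f zero j ⊥ g u i
    f₀⊥g {j} u i = proj₁ (proj₂ (project (f zero) (f (suc u) i))) j

    g≡f : ∀ u i → g u i ≡ f (suc u) i modulo f zero
    g≡f u i = proj₂ (proj₂ (project (f zero) (f (suc u) i)))

    ⟨g,g⟩-≢p : ∀ u v i j → u ≢ p → ⟨ g u i , g v j ⟩ ≈ ⟨ f (suc u) i , f (suc v) j ⟩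
    ⟨g,g⟩-≢p u v i j u≢p = begin
      ⟨ g u i , g v j ⟩               ≈⟨ g≡f u i (g v j) (λ _ → f₀⊥g v j) ⟩
      ⟨ f (suc u) i , g v j ⟩         ≈⟨ ⟨⟩-conj _ _ ⟩
      conj ⟨ g v j , f (suc u) i ⟩    ≈⟨ conj-cong (g≡f v j (f (suc u) i)
                                           (λ l → nonadjacent (λ ()) (u≢p ∘ only-p u ∘ proj₁))) ⟩
      conj ⟨ f (suc v) j , f (suc u) i ⟩  ≈⟨ ⟨⟩-conj _ _ ⟨
      ⟨ f (suc u) i , f (suc v) j ⟩   ∎

    ⟨g,g⟩ : ∀ {u v} i j → u ≢ v → ⟨ g u i , g v j ⟩ ≈ ⟨ f (suc u) i , f (suc v) j ⟩
    ⟨g,g⟩ {u} {v} i j u≢v with u Fin.≟ p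
    ... | no  u≢p    = ⟨g,g⟩-≢p u v i j u≢p
    -- As `u` and `v` differ, `v` is not `p`; conjugate symmetry exchanges the two.
    ... | yes ≡.refl = trans (⟨⟩-conj _ _)
      (trans (conj-cong (⟨g,g⟩-≢p v u j i (u≢v ∘ ≡.sym))) (sym (⟨⟩-conj _ _)))

    g-rep : Represents (comap suc G) g
    g-rep = record
      { nonadjacent = λ {u} {v} {i} {j} u≢v ¬adj →
          trans (⟨g,g⟩ i j u≢v) (nonadjacent (u≢v ∘ Fin.suc-injective) ¬adj)
      ; adjacent    = λ {u} {v} {i} u~v → adjacent u~v ∘
          trans (sym (⟨g,g⟩ i i (λ { ≡.refl → SimpleGraph.loopless G u~v })))
      }

    xₛ : Fin k → Fin m → Carrier
    xₛ = x ∘ suc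

    z : Carrierᴹ
    z = combination₂ xₛ g

    f₀⊥z : ∀ j → f zero j ⊥ z
    f₀⊥z j = ⊥-sym (combination₂-⊥ xₛ (λ u i → ⊥-*ˡ (xₛ u i) (⊥-sym (f₀⊥g u i))))

    rest⊥ : ∀ {w} → combination (x zero) (f zero) ⊥ w → combination₂ xₛ (f ∘ suc) ⊥ w
    rest⊥ {w} x₀f₀⊥w = begin
      ⟨ combination₂ xₛ (f ∘ suc) , w ⟩           ≈⟨ +-identityˡ _ ⟨
      0# + ⟨ combination₂ xₛ (f ∘ suc) , w ⟩      ≈⟨ +-congʳ x₀f₀⊥w ⟨
      ⟨ combination (x zero) (f zero) , w ⟩ + ⟨ combination₂ xₛ (f ∘ suc) , w ⟩
                                                  ≈⟨ ⟨⟩-+ˡ _ _ _ ⟨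
      ⟨ combination₂ x f , w ⟩                    ≈⟨ ⊥-respˡ (≈ᴹ-sym xf≈0) 0⊥ ⟩
      0#                                          ∎

    -- `z` is orthogonal to the leaf's copy, so in `⟨ z , z ⟩` the left `g` may be replaced by `f`;
    -- the relation then moves everything onto the leaf's copy.
    z≈0 : z ≈ᴹ 0ᴹ
    z≈0 = ⟨⟩-def z (begin
      ⟨ z , z ⟩
        ≈⟨ ⟨⟩-combination₂ xₛ g z ⟩
      sum (λ u → sum (λ i → xₛ u i * ⟨ g u i , z ⟩))
        ≈⟨ sum-cong-≋ {k} (λ u → sum-cong-≋ {m} (λ i → *-congˡ (g≡f u i z f₀⊥z))) ⟩
      sum (λ u → sum (λ i → xₛ u i * ⟨ f (suc u) i , z ⟩))
        ≈⟨ ⟨⟩-combination₂ xₛ (f ∘ suc) z ⟨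
      ⟨ combination₂ xₛ (f ∘ suc) , z ⟩
        ≈⟨ rest⊥ (⊥-sumˡ (λ i → ⊥-*ˡ (x zero i) (f₀⊥z i))) ⟩
      0#  ∎)

    xₛ≈0 : ∀ u j → xₛ u j ≈ 0#
    xₛ≈0 = vanishing order g-rep xₛ x-root≈0 z≈0

    -- Of the leaf's copy only member `j` is adjacent to `f (suc p) j`, so pairing isolates
    -- `x zero j`.
    x₀≈0 : ∀ j → x zero j ≈ 0#
    x₀≈0 j = *-cancelˡ-0 (adjacent 0~p) (begin
      ⟨ f zero j , f (suc p) j ⟩ * x zero j       ≈⟨ *-comm _ _ ⟩
      x zero j * ⟨ f zero j , f (suc p) j ⟩       ≈⟨ sum-single j (λ i i≢j →
        trans (*-congˡ (nonadjacent (λ ()) (i≢j ∘ proj₂))) (zeroʳ _)) ⟨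
      sum (λ i → x zero i * ⟨ f zero i , f (suc p) j ⟩)
                                                  ≈⟨ ⟨⟩-combination (x zero) (f zero) _ ⟨
      ⟨ combination (x zero) (f zero) , w ⟩       ≈⟨ +-identityʳ _ ⟨
      ⟨ combination (x zero) (f zero) , w ⟩ + 0#  ≈⟨ +-congˡ rest⊥w ⟨
      ⟨ combination (x zero) (f zero) , w ⟩ + ⟨ combination₂ xₛ (f ∘ suc) , w ⟩
                                                  ≈⟨ ⟨⟩-+ˡ _ _ _ ⟨
      ⟨ combination₂ x f , w ⟩                    ≈⟨ ⊥-respˡ (≈ᴹ-sym xf≈0) 0⊥ ⟩
      0#                                          ∎)
      where
      w = f (suc p) j

      rest⊥w : combination₂ xₛ (f ∘ suc) ⊥ w
      rest⊥w = combination₂-⊥ xₛ (λ u i →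
        trans (⟨⟩-*ˡ _ _ _) (trans (*-congʳ (xₛ≈0 u i)) (zeroˡ _)))

  -- A homogeneous system replaces ranks: `d` equations make the combination orthogonal to `e`,
  -- hence zero, and `m` more annihilate the coefficients at the root. More than `d + m` unknowns
  -- would leave a nontrivial solution.
  dimension-≥ : ∀ {k m d} {G : SimpleGraph (Fin k)} → LeafOrder G →
    {f : Fin k → Fin m → Carrierᴹ} → Represents G f → {e : Fin d → Carrierᴹ} → Total e →
    k ℕ.* m ℕ.≤ d ℕ.+ m
  dimension-≥ {k} {m} {d} order {f} f-rep {e} total = ℕ.≮⇒≥ λ d+m<k*m →
    let (X , (i , Xi≉0) , solution) = kernel d+m<k*m M in
    Xi≉0 (≡.subst (λ i → X i ≈ 0#) (Fin.combine-remQuot {k} m i)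
      (X≈0 X solution (proj₁ (remQuot {k} m i)) (proj₂ (remQuot {k} m i))))
    where
    eᵣ : Fin (k ℕ.* m) → Fin (k ℕ.* m) → Carrier
    eᵣ i j with i Fin.≟ j
    ... | yes _ = 1#
    ... | no  _ = 0#

    M : Fin (d ℕ.+ m) → Fin (k ℕ.* m) → Carrier
    M r i = [ (λ s → ⟨ uncurry f (remQuot {k} m i) , e s ⟩)
            , (λ j → eᵣ (combine (root order) j) i) ]′ (splitAt d r)

    module _ (X : Fin (k ℕ.* m) → Carrier) (solution : ∀ r → sum (λ i → M r i * X i) ≈ 0#) where
      x : Fin k → Fin m → Carrier
      x u j = X (combine u j)

      x-root≈0 : ∀ j → x (root order) j ≈ 0#
      -- Abstracting `splitAt` lets the row of `M` in the type of `solution` compute.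
      x-root≈0 j with splitAt d {m} (d ↑ʳ j) | Fin.splitAt-↑ʳ d m j | solution (d ↑ʳ j)
      ... | _ | ≡.refl | eq = begin
        X c                          ≈⟨ *-identityˡ _ ⟨
        1# * X c                     ≈⟨ *-congʳ eᵣ-diagonal ⟨
        eᵣ c c * X c                 ≈⟨ sum-single c (λ i i≢c → trans (*-congʳ (eᵣ-off i≢c)) (zeroˡ _)) ⟨
        sum (λ i → eᵣ c i * X i)     ≈⟨ eq ⟩
        0#                           ∎
        where
        c = combine (root order) j

        eᵣ-diagonal : eᵣ c c ≈ 1#
        eᵣ-diagonal with c Fin.≟ c
        ... | yes _  = refl
        ... | no c≢c = contradiction ≡.refl c≢c

        eᵣ-off : ∀ {i} → i ≢ c → eᵣ c i ≈ 0#
        eᵣ-off {i} i≢c with c Fin.≟ i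
        ... | yes c≡i = contradiction (≡.sym c≡i) i≢c
        ... | no _    = refl

      xf⊥e : ∀ s → combination₂ x f ⊥ e s
      xf⊥e s with splitAt d {m} (s ↑ˡ m) | Fin.splitAt-↑ˡ d s m | solution (s ↑ˡ m)
      ... | _ | ≡.refl | eq = begin
        ⟨ combination₂ x f , e s ⟩
          ≈⟨ ⟨⟩-combination₂ x f (e s) ⟩
        sum (λ u → sum (λ j → x u j * ⟨ f u j , e s ⟩))
          ≈⟨ sum-cong-≋ {k} (λ u → sum-cong-≋ {m} (λ j → trans (*-comm _ _) (*-congʳ
               (reflexive (≡.cong (λ q → ⟨ uncurry f q , e s ⟩)
                 (≡.sym (Fin.remQuot-combine {k} {m} u j))))))) ⟩
        sum (λ u → sum (λ j →
          ⟨ uncurry f (remQuot {k} m (combine {k} {m} u j)) , e s ⟩ * X (combine {k} {m} u j)))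
          ≈⟨ sum-combine k {m} (λ i → ⟨ uncurry f (remQuot {k} m i) , e s ⟩ * X i) ⟨
        sum (λ i → ⟨ uncurry f (remQuot {k} m i) , e s ⟩ * X i)
          ≈⟨ eq ⟩
        0#  ∎

      X≈0 : ∀ u j → x u j ≈ 0#
      X≈0 = vanishing order f-rep x x-root≈0 (total _ (λ s → ⊥-sym (xf⊥e s)))

-- The construction

module Construction {ℝ : RealNumbers} {𝔽 : Scalars ℝ} (L : ConjugationLaws 𝔽)
                    {a ℓ : Level} (H : InnerProductSpace 𝔽 a ℓ) where
  open Scalars 𝔽 hiding (zero)
  open ConjugationLaws L
  open FieldTheory 𝔽 L
  open InnerProductSpace H
  open Geometry L H
  open LowerBound L H
  open RingProperties ring using (-1*x≈-x)
  open Sum +-commutativeMonoid using (sum; sum-cong-≋; ∑-distrib-+)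
  open SemiringSum semiring using (*-distribˡ-sum; *-distribʳ-sum)
  open RingSolver commutativeSemiring using (solve; _:+_; _:*_; _:=_)
  open SetoidReasoning setoid
  private
    module ℝ where
      open RealNumbers ℝ public hiding (zero)
      open OrderedField ℝ public
    module Sumᴹ = Sum +ᴹ-commutativeMonoid

  -- With h = Σ εⱼ, wⱼ = ∥ εⱼ ∥² and W = ∥ h ∥², the vectors εⱼ + wⱼ h have
  -- positive inner products, and (1 + W) εⱼ - wⱼ h is a rescaled dual basis
  -- with negative inner products.
  module Block {m : ℕ} {ε : Fin m → Carrierᴹ} (orth : Orthogonal ε) (ε≉0 : Nonzero ε) where
    h : Carrierᴹ
    h = Sumᴹ.sum ε

    w : Fin m → Carrier
    w j = ⟨ ε j , ε j ⟩

    W : Carrier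
    W = ⟨ h , h ⟩

    scale : Bool → Carrier
    scale true  = 1#
    scale false = 1# + W

    vec : Bool → Fin m → Carrierᴹ
    vec s j = scale s *ₗ ε j +ᴹ (sign s * w j) *ₗ h

    w-positive : ∀ j → Positive (w j)
    w-positive j = ⟨x,x⟩-positive (ε≉0 j)

    scale-positive : ∀ s → Positive (scale s)
    scale-positive true  = positive-1
    scale-positive false = ℝ.1# ℝ.+ ∥ h ∥² , ℝ.+-nonNegative ℝ.0≤1 (⟨⟩-nonNeg h) ,
      ℝ.1≉0 ∘ ℝ.x+y≈0⇒x≈0 ℝ.0≤1 (⟨⟩-nonNeg h) ,
      trans (+-cong (sym ι-1#) (⟨x,x⟩≈ι∥x∥² h)) (sym (ι-+ _ _))

    -- Pairing with `h` and summing a family both produce this factor; that it is the scale of the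
    -- other family makes the two cases symmetric.
    scale-not : ∀ s → scale s + sign s * W ≈ scale (not s)
    scale-not true  = +-congˡ (*-identityˡ W)
    scale-not false = trans (+-assoc _ _ _) (trans
      (+-congˡ (trans (+-congˡ (-1*x≈-x W)) (-‿inverseʳ W))) (+-identityʳ 1#))

    ⟨h,ε⟩ : ∀ j → ⟨ h , ε j ⟩ ≈ w j
    ⟨h,ε⟩ j = trans (⟨⟩-sumˡ ε (ε j)) (sum-single j (λ i → orth))

    ⟨ε,h⟩ : ∀ j → ⟨ ε j , h ⟩ ≈ w j
    ⟨ε,h⟩ j = trans (⟨⟩-conj _ _)
      (trans (conj-cong (⟨h,ε⟩ j)) (positive⇒conj≈ (w-positive j)))

    W≈Σw : W ≈ sum w
    W≈Σw = trans (⟨⟩-sumˡ ε h) (sum-cong-≋ ⟨ε,h⟩)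

    ⟨vec,⟩ : ∀ s j x → ⟨ vec s j , x ⟩ ≈ scale s * ⟨ ε j , x ⟩ + sign s * w j * ⟨ h , x ⟩
    ⟨vec,⟩ s j x = trans (⟨⟩-+ˡ _ _ _) (+-cong (⟨⟩-*ˡ _ _ _) (⟨⟩-*ˡ _ _ _))

    ⟨,vec⟩ : ∀ s j x → ⟨ x , vec s j ⟩ ≈ scale s * ⟨ x , ε j ⟩ + sign s * w j * ⟨ x , h ⟩
    ⟨,vec⟩ s j x = trans (⟨⟩-+ʳ _ _ _) (+-cong
      (trans (⟨⟩-*ʳ _ _ _) (*-congʳ (positive⇒conj≈ (scale-positive s))))
      (trans (⟨⟩-*ʳ _ _ _) (*-congʳ (trans (conj-* _ _)
        (*-cong (conj-sign s) (positive⇒conj≈ (w-positive j)))))))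

    ⟨h,vec⟩ : ∀ s j → ⟨ h , vec s j ⟩ ≈ scale (not s) * w j
    ⟨h,vec⟩ s j = begin
      ⟨ h , vec s j ⟩                                ≈⟨ ⟨,vec⟩ s j h ⟩
      scale s * ⟨ h , ε j ⟩ + sign s * w j * W       ≈⟨ +-congʳ (*-congˡ (⟨h,ε⟩ j)) ⟩
      scale s * w j + sign s * w j * W               ≈⟨ solve 4 (λ c σ w W →
                                                          c :* w :+ σ :* w :* W := (c :+ σ :* W) :* w)
                                                          refl (scale s) (sign s) (w j) W ⟩
      (scale s + sign s * W) * w j                   ≈⟨ *-congʳ (scale-not s) ⟩
      scale (not s) * w j                            ∎

    ⟨vec,vec⟩ : ∀ s t j k → ⟨ vec s j , vec t k ⟩ ≈
      scale s * scale t * ⟨ ε j , ε k ⟩ +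
      (scale s * sign t + sign s * scale (not t)) * (w j * w k)
    ⟨vec,vec⟩ s t j k = begin
      ⟨ vec s j , vec t k ⟩
        ≈⟨ ⟨vec,⟩ s j (vec t k) ⟩
      scale s * ⟨ ε j , vec t k ⟩ + sign s * w j * ⟨ h , vec t k ⟩
        ≈⟨ +-cong (*-congˡ (trans (⟨,vec⟩ t k (ε j)) (+-congˡ (*-congˡ (⟨ε,h⟩ j)))))
             (*-congˡ (⟨h,vec⟩ t k)) ⟩
      scale s * (scale t * ⟨ ε j , ε k ⟩ + sign t * w k * w j) + sign s * w j * (scale (not t) * w k)
        ≈⟨ solve 8 (λ cs ct e σt wk wj σs c →
             cs :* (ct :* e :+ σt :* wk :* wj) :+ σs :* wj :* (c :* wk) :=
             cs :* ct :* e :+ (cs :* σt :+ σs :* c) :* (wj :* wk))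
             refl (scale s) (scale t) ⟨ ε j , ε k ⟩ (sign t) (w k) (w j) (sign s) (scale (not t)) ⟩
      scale s * scale t * ⟨ ε j , ε k ⟩ + (scale s * sign t + sign s * scale (not t)) * (w j * w k)  ∎

    -- Off the diagonal the `ε` part vanishes, and the rank-one part is `sign s` times a positive
    -- number.
    vec-hasSign : ∀ s {j k} → j ≢ k → HasSign s ⟨ vec s j , vec s k ⟩
    vec-hasSign s {j} {k} j≢k = positive-resp (sym (begin
      sign s * ⟨ vec s j , vec s k ⟩
        ≈⟨ *-congˡ (trans (⟨vec,vec⟩ s s j k)
             (trans (+-congʳ (trans (*-congˡ (orth j≢k)) (zeroʳ _))) (+-identityˡ _))) ⟩
      sign s * ((scale s * sign s + sign s * scale (not s)) * (w j * w k))
        ≈⟨ solve 4 (λ σ c d w → σ :* ((c :* σ :+ σ :* d) :* w) := σ :* σ :* ((c :+ d) :* w))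
             refl (sign s) (scale s) (scale (not s)) (w j * w k) ⟩
      sign s * sign s * ((scale s + scale (not s)) * (w j * w k))
        ≈⟨ trans (*-congʳ (sign*sign s)) (*-identityˡ _) ⟩
      (scale s + scale (not s)) * (w j * w k)  ∎))
      (positive-* (positive-+ (scale-positive s) (scale-positive (not s)))
        (positive-* (w-positive j) (w-positive k)))

    -- The opposite signs cancel the rank-one part, which leaves a diagonal Gram matrix.
    ⟨vec,vec-not⟩ : ∀ s j k → ⟨ vec (not s) j , vec s k ⟩ ≈ scale (not s) * scale s * ⟨ ε j , ε k ⟩
    ⟨vec,vec-not⟩ s j k = begin
      ⟨ vec (not s) j , vec s k ⟩
        ≈⟨ ⟨vec,vec⟩ (not s) s j k ⟩
      scale (not s) * scale s * ⟨ ε j , ε k ⟩ +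
      (scale (not s) * sign s + sign (not s) * scale (not s)) * (w j * w k)
        ≈⟨ +-congˡ (*-congʳ (solve 3 (λ c σ τ → c :* σ :+ τ :* c := c :* (τ :+ σ))
             refl (scale (not s)) (sign s) (sign (not s)))) ⟩
      scale (not s) * scale s * ⟨ ε j , ε k ⟩ + scale (not s) * (sign (not s) + sign s) * (w j * w k)
        ≈⟨ +-congˡ (trans (*-congʳ (trans (*-congˡ (sign-not s)) (zeroʳ _))) (zeroˡ _)) ⟩
      scale (not s) * scale s * ⟨ ε j , ε k ⟩ + 0#
        ≈⟨ +-identityʳ _ ⟩
      scale (not s) * scale s * ⟨ ε j , ε k ⟩  ∎

    vec-not-⊥ : ∀ s {j k} → j ≢ k → vec (not s) j ⊥ vec s k
    vec-not-⊥ s j≢k = trans (⟨vec,vec-not⟩ s _ _) (trans (*-congˡ (orth j≢k)) (zeroʳ _))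

    vec-not-⊥̸ : ∀ s j → ¬ (vec (not s) j ⊥ vec s j)
    vec-not-⊥̸ s j = positive⇒≉0 (positive-resp (sym (⟨vec,vec-not⟩ s j j))
      (positive-* (positive-* (scale-positive (not s)) (scale-positive s)) (w-positive j)))

    vec-⊥ : ∀ s j {z} → (∀ i → ε i ⊥ z) → vec s j ⊥ z
    vec-⊥ s j ε⊥z = ⊥-+ˡ (⊥-*ˡ _ (ε⊥z j)) (⊥-*ˡ _ (⊥-sumˡ ε⊥z))

    Σvec : ∀ s → Sumᴹ.sum (vec s) ≈ᴹ scale (not s) *ₗ h
    Σvec s = ⟨⟩-extensional λ z → begin
      ⟨ Sumᴹ.sum (vec s) , z ⟩
        ≈⟨ ⟨⟩-sumˡ (vec s) z ⟩
      sum (λ j → ⟨ vec s j , z ⟩)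
        ≈⟨ sum-cong-≋ (λ j → ⟨vec,⟩ s j z) ⟩
      sum (λ j → scale s * ⟨ ε j , z ⟩ + sign s * w j * ⟨ h , z ⟩)
        ≈⟨ ∑-distrib-+ (λ j → scale s * ⟨ ε j , z ⟩) (λ j → sign s * w j * ⟨ h , z ⟩) ⟩
      sum (λ j → scale s * ⟨ ε j , z ⟩) + sum (λ j → sign s * w j * ⟨ h , z ⟩)
        ≈⟨ +-cong (*-distribˡ-sum (scale s) (λ j → ⟨ ε j , z ⟩))
                 (*-distribʳ-sum ⟨ h , z ⟩ (λ j → sign s * w j)) ⟨
      scale s * sum (λ j → ⟨ ε j , z ⟩) + sum (λ j → sign s * w j) * ⟨ h , z ⟩
        ≈⟨ +-cong (*-congˡ (⟨⟩-sumˡ ε z)) (*-congʳ (*-distribˡ-sum (sign s) w)) ⟨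
      scale s * ⟨ h , z ⟩ + sign s * sum w * ⟨ h , z ⟩
        ≈⟨ distribʳ _ _ _ ⟨
      (scale s + sign s * sum w) * ⟨ h , z ⟩
        ≈⟨ *-congʳ (trans (+-congˡ (*-congˡ (sym W≈Σw))) (scale-not s)) ⟩
      scale (not s) * ⟨ h , z ⟩
        ≈⟨ ⟨⟩-*ˡ _ _ _ ⟨
      ⟨ scale (not s) *ₗ h , z ⟩  ∎

    -- Each family alone recovers its block: its sum is a positive multiple of `h`, and subtracting
    -- the `h` part leaves multiples of the `ε j`.
    vec-covers : ∀ s {P} → IsSubspace P → (∀ j → P (vec s j)) → ∀ j → P (ε j)
    vec-covers s {P} isSubspace Pvec = λ j → cancel (scale-positive s)
      (resp (≈ᴹ-sym (scale*ε j)) (+-closed (Pvec j) (*-closed _ Ph)))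
      where
      open IsSubspace isSubspace

      cancel : ∀ {c x} → Positive c → P (c *ₗ x) → P x
      cancel {c} {x} c-pos Pcx = let (u , cu≈1) = inverse c (positive⇒≉0 c-pos) in
        resp (≈ᴹ-trans (≈ᴹ-sym (*ₗ-assoc u c x))
          (≈ᴹ-trans (*ₗ-congʳ (trans (*-comm u c) cu≈1)) (*ₗ-identityˡ x)))
          (*-closed u Pcx)

      Ph : P h
      Ph = cancel (scale-positive (not s)) (resp (Σvec s) (sum-closed Pvec))

      scale*ε : ∀ j → scale s *ₗ ε j ≈ᴹ vec s j +ᴹ (- (sign s * w j)) *ₗ h
      scale*ε j = ≈ᴹ-sym (≈ᴹ-trans (+ᴹ-assoc _ _ _) (≈ᴹ-trans
        (+ᴹ-congˡ (≈ᴹ-trans (≈ᴹ-sym (*ₗ-distribʳ h _ _))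
          (≈ᴹ-trans (*ₗ-congʳ (-‿inverseʳ _)) (*ₗ-zeroˡ h))))
        (+ᴹ-identityʳ _)))

  -- One block `g e` for each edge. The members of `η`, the additional directions at the root, may
  -- be zero, which allows any number of them up to `m`.
  record OrthogonalBlocks {k m} (η : Fin m → Carrierᴹ) (g : Fin k → Fin m → Carrierᴹ) : Set (a ⊔ ℓ) where
    field
      η-orth    : Orthogonal η
      g-orth    : ∀ e → Orthogonal (g e)
      g-nonzero : ∀ e → Nonzero (g e)
      g⊥g       : ∀ {e e′} i j → e ≢ e′ → g e i ⊥ g e′ j
      η⊥g       : ∀ i e j → η i ⊥ g e j

  -- The first alternative in `f-hasSign` is the tree with one vertex, whose copy still consists of
  -- the orthogonal `η`. `f-⊥` keeps the vectors inside the blocks used so far, and `f-covers` says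
  -- that they span them.
  record Realisation {k m} (G : SimpleGraph (Fin (suc k)))
                     (η : Fin m → Carrierᴹ) (g : Fin k → Fin m → Carrierᴹ) : Set (lsuc a ⊔ ℓ) where
    field
      f          : Fin (suc k) → Fin m → Carrierᴹ
      colour     : Fin (suc k) → Bool
      represents : Represents G f
      f-hasSign  : ∀ u {i j} → i ≢ j →
        (k ≡ 0 × f u i ⊥ f u j) ⊎ HasSign (colour u) ⟨ f u i , f u j ⟩
      f-⊥        : ∀ {z} → (∀ j → η j ⊥ z) → (∀ e j → g e j ⊥ z) → ∀ u i → f u i ⊥ z
      f-covers   : ∀ P → IsSubspace P → (∀ u i → P (f u i)) →
        (∀ j → P (η j)) × (∀ e j → P (g e j))

  addLeaf : ∀ {k m} {G : SimpleGraph (Fin (suc (suc k)))} {η : Fin m → Carrierᴹ}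
    {g : Fin (suc k) → Fin m → Carrierᴹ} (p : Fin (suc k)) → let open SimpleGraph G in
    zero ~ suc p → (∀ q → zero ~ suc q → q ≡ p) → OrthogonalBlocks η g →
    Realisation (comap suc G) η (g ∘ suc) → Realisation G η g
  addLeaf {k} {m} {G} {η} {g} p 0~p only-p blocks R = record
    { f          = f
    ; colour     = colour
    ; represents = record { nonadjacent = nonadjacent _ _ ; adjacent = adjacent _ _ }
    ; f-hasSign  = f-hasSign
    ; f-⊥        = f-⊥
    ; f-covers   = f-covers
    }
    where
    open OrthogonalBlocks blocks
    open Block (g-orth zero) (g-nonzero zero)
    open SimpleGraph G
    module R = Realisation R
    module Rep = Represents R.represents

    -- The neighbour keeps its sign; duality forces the opposite one on the leaf.
    s : Bool
    s = R.colour p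

    extra : Fin (suc k) → Fin m → Carrierᴹ
    extra u i with u Fin.≟ p
    ... | yes _ = vec s i
    ... | no  _ = 0ᴹ

    f : Fin (suc (suc k)) → Fin m → Carrierᴹ
    f zero    i = vec (not s) i
    f (suc u) i = R.f u i +ᴹ extra u i

    colour : Fin (suc (suc k)) → Bool
    colour zero    = not s
    colour (suc u) = R.colour u

    g₀⊥R : ∀ j u i → g zero j ⊥ R.f u i
    g₀⊥R j u i = ⊥-sym (R.f-⊥ (λ l → η⊥g l zero j) (λ e l → g⊥g l j λ ()) u i)

    extra-⊥ : ∀ u i {z} → (∀ j → g zero j ⊥ z) → extra u i ⊥ z
    extra-⊥ u i g₀⊥z with u Fin.≟ p
    ... | yes _ = vec-⊥ s i g₀⊥z
    ... | no  _ = 0⊥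

    vec-extra-⊥ : ∀ u {i j} → ¬ (u ≡ p × i ≡ j) → vec (not s) i ⊥ extra u j
    vec-extra-⊥ u ¬eq with u Fin.≟ p
    ... | yes u≡p = vec-not-⊥ s (λ i≡j → ¬eq (u≡p , i≡j))
    ... | no  _   = ⊥-sym 0⊥

    extra-extra-⊥ : ∀ u v {i j} → u ≢ v → extra u i ⊥ extra v j
    extra-extra-⊥ u v u≢v with u Fin.≟ p | v Fin.≟ p
    ... | yes u≡p | yes v≡p = contradiction (≡.trans u≡p (≡.sym v≡p)) u≢v
    ... | yes _   | no  _   = ⊥-sym 0⊥
    ... | no  _   | _       = 0⊥

    ⟨f₀,f⟩ : ∀ u i j → ⟨ f zero i , f (suc u) j ⟩ ≈ ⟨ vec (not s) i , extra u j ⟩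
    ⟨f₀,f⟩ u i j = trans (⟨⟩-+ʳ _ _ _)
      (trans (+-congʳ (vec-⊥ (not s) i (λ l → g₀⊥R l u j))) (+-identityˡ _))

    ⟨f,f⟩ : ∀ u v i j → ⟨ f (suc u) i , f (suc v) j ⟩ ≈
      ⟨ R.f u i , R.f v j ⟩ + ⟨ extra u i , extra v j ⟩
    ⟨f,f⟩ u v i j = begin
      ⟨ f (suc u) i , f (suc v) j ⟩
        ≈⟨ trans (⟨⟩-+ˡ _ _ _) (+-cong (⟨⟩-+ʳ _ _ _) (⟨⟩-+ʳ _ _ _)) ⟩
      (⟨ R.f u i , R.f v j ⟩ + ⟨ R.f u i , extra v j ⟩) +
      (⟨ extra u i , R.f v j ⟩ + ⟨ extra u i , extra v j ⟩)
        ≈⟨ +-cong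
             (trans (+-congˡ (⊥-sym (extra-⊥ v j (λ l → g₀⊥R l u i)))) (+-identityʳ _))
             (trans (+-congʳ (extra-⊥ u i (λ l → g₀⊥R l v j))) (+-identityˡ _)) ⟩
      ⟨ R.f u i , R.f v j ⟩ + ⟨ extra u i , extra v j ⟩  ∎

    nonadjacent : ∀ u v {i j} → u ≢ v → ¬ (u ~ v × i ≡ j) → f u i ⊥ f v j
    nonadjacent zero    zero    u≢v ¬adj = contradiction ≡.refl u≢v
    nonadjacent zero    (suc v) u≢v ¬adj = trans (⟨f₀,f⟩ v _ _)
      (vec-extra-⊥ v λ { (≡.refl , i≡j) → ¬adj (0~p , i≡j) })
    nonadjacent (suc u) zero    u≢v ¬adj = ⊥-sym (trans (⟨f₀,f⟩ u _ _)
      (vec-extra-⊥ u λ { (≡.refl , i≡j) → ¬adj (symmetric 0~p , ≡.sym i≡j) }))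
    nonadjacent (suc u) (suc v) u≢v ¬adj = trans (⟨f,f⟩ u v _ _) (trans
      (+-cong (Rep.nonadjacent (u≢v ∘ ≡.cong suc) ¬adj) (extra-extra-⊥ u v (u≢v ∘ ≡.cong suc)))
      (+-identityˡ 0#))

    f₀⊥̸fₚ : ∀ i → ¬ (f zero i ⊥ f (suc p) i)
    f₀⊥̸fₚ i f₀⊥fₚ with p Fin.≟ p | ⟨f₀,f⟩ p i i
    ... | yes _  | eq = vec-not-⊥̸ s i (trans (sym eq) f₀⊥fₚ)
    ... | no p≢p | _  = p≢p ≡.refl

    adjacent : ∀ u v {i} → u ~ v → ¬ (f u i ⊥ f v i)
    adjacent zero    zero    u~v = contradiction u~v loopless
    adjacent zero    (suc v) u~v with only-p v u~v
    ... | ≡.refl = f₀⊥̸fₚ _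
    adjacent (suc u) zero    u~v with only-p u (symmetric u~v)
    ... | ≡.refl = f₀⊥̸fₚ _ ∘ ⊥-sym
    adjacent (suc u) (suc v) u~v fu⊥fv = Rep.adjacent u~v (trans (sym (+-identityʳ _))
      (trans (+-congˡ (sym (extra-extra-⊥ u v λ { ≡.refl → loopless u~v })))
        (trans (sym (⟨f,f⟩ u v _ _)) fu⊥fv)))

    f-hasSign : ∀ u {i j} → i ≢ j →
      (suc k ≡ 0 × f u i ⊥ f u j) ⊎ HasSign (colour u) ⟨ f u i , f u j ⟩
    f-hasSign zero    i≢j = inj₂ (vec-hasSign (not s) i≢j)
    f-hasSign (suc u) {i} {j} i≢j = inj₂ (hasSign-resp (R.colour u) (sym (⟨f,f⟩ u u i j)) sign-sum)
      where
      sign-sum : HasSign (R.colour u) (⟨ R.f u i , R.f u j ⟩ + ⟨ extra u i , extra u j ⟩)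
      sign-sum with u Fin.≟ p | R.f-hasSign u i≢j
      -- The first edge at the root: the new block alone makes its copy complete.
      ... | yes ≡.refl | inj₁ (_ , ⊥) =
        hasSign-resp (R.colour u) (sym (trans (+-congʳ ⊥) (+-identityˡ _))) (vec-hasSign s i≢j)
      ... | yes ≡.refl | inj₂ signed  = hasSign-+ s signed (vec-hasSign s i≢j)
      ... | no u≢p     | inj₂ signed  =
        hasSign-resp (R.colour u) (sym (trans (+-congˡ 0⊥) (+-identityʳ _))) signed
      -- There was only one vertex, so it is `p`.
      ... | no u≢p     | inj₁ (≡.refl , _) = contradiction (only u p) u≢p
        where
        only : (u v : Fin 1) → u ≡ v
        only zero zero = ≡.refl

    f-⊥ : ∀ {z} → (∀ j → η j ⊥ z) → (∀ e j → g e j ⊥ z) → ∀ u i → f u i ⊥ z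
    f-⊥ η⊥z g⊥z zero    i = vec-⊥ (not s) i (g⊥z zero)
    f-⊥ η⊥z g⊥z (suc u) i = ⊥-+ˡ (R.f-⊥ η⊥z (g⊥z ∘ suc) u i) (extra-⊥ u i (g⊥z zero))

    f-covers : ∀ P → IsSubspace P → (∀ u i → P (f u i)) →
      (∀ j → P (η j)) × (∀ e j → P (g e j))
    f-covers P isSubspace Pf = proj₁ IH , λ { zero → Pg₀ ; (suc e) → proj₂ IH e }
      where
      open IsSubspace isSubspace

      Pg₀ : ∀ j → P (g zero j)
      Pg₀ = vec-covers (not s) isSubspace (Pf zero)

      Pextra : ∀ u i → P (extra u i)
      Pextra u i with u Fin.≟ p
      ... | yes _ = +-closed (*-closed _ (Pg₀ i)) (*-closed _ (sum-closed Pg₀))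
      ... | no  _ = 0-closed

      -- The leaf's copy already yields the new block, so the share given to the neighbour can be
      -- subtracted.
      PR : ∀ u i → P (R.f u i)
      PR u i = resp (x+y-y≈x _ _) (+-closed (Pf (suc u) i) (*-closed (- 1#) (Pextra u i)))

      IH = R.f-covers P isSubspace PR

  realise : ∀ {k m} {G : SimpleGraph (Fin (suc k))} → LeafOrder G →
    ∀ {η : Fin m → Carrierᴹ} {g} → OrthogonalBlocks η g → Realisation G η g
  realise {zero} {G = G} single {η} blocks = record
    { f          = λ _ → η
    ; colour     = λ _ → true
    ; represents = record
      { nonadjacent = λ { {zero} {zero} u≢v → contradiction ≡.refl u≢v }
      ; adjacent    = λ { {zero} {zero} u~v → contradiction u~v (SimpleGraph.loopless G) }
      }
    ; f-hasSign  = λ _ i≢j → inj₁ (≡.refl , OrthogonalBlocks.η-orth blocks i≢j)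
    ; f-⊥        = λ η⊥z _ _ → η⊥z
    ; f-covers   = λ _ _ Pf → Pf zero , λ ()
    }
  realise {suc k} (leaf order p 0~p only-p) {g = g} blocks =
    addLeaf p 0~p only-p blocks (realise order record
      { η-orth    = η-orth
      ; g-orth    = g-orth ∘ suc
      ; g-nonzero = g-nonzero ∘ suc
      ; g⊥g       = λ i j e≢e′ → g⊥g i j (e≢e′ ∘ Fin.suc-injective)
      ; η⊥g       = λ i → η⊥g i ∘ suc
      })
    where open OrthogonalBlocks blocks

-- Distributing a basis over the edges, and the product graph

open import Data.Nat.Base using (_+_; _*_; _∸_; _≤_)

module Theorem {ℝ : RealNumbers} {𝔽 : Scalars ℝ} (L : ConjugationLaws 𝔽)
               {a ℓ : Level} (H : InnerProductSpace 𝔽 a ℓ) where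
  open InnerProductSpace H
  open FieldTheory 𝔽 L
  open Geometry L H
  open LowerBound L H
  open Construction L H
  private module 𝔽 = Scalars 𝔽

  pad : ∀ {r m} → r ≤ m → (Fin r → Carrierᴹ) → Fin m → Carrierᴹ
  pad z≤n       B _       = 0ᴹ
  pad (s≤s r≤m) B zero    = B zero
  pad (s≤s r≤m) B (suc j) = pad r≤m (B ∘ suc) j

  pad-⊥ : ∀ {r m} (r≤m : r ≤ m) {B z} → (∀ i → B i ⊥ z) → ∀ j → pad r≤m B j ⊥ z
  pad-⊥ z≤n       B⊥z _       = 0⊥
  pad-⊥ (s≤s r≤m) B⊥z zero    = B⊥z zero
  pad-⊥ (s≤s r≤m) B⊥z (suc j) = pad-⊥ r≤m (B⊥z ∘ suc) j

  pad-orthogonal : ∀ {r m} (r≤m : r ≤ m) {B} → Orthogonal B → Orthogonal (pad r≤m B)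
  pad-orthogonal z≤n       orth _ = 0⊥
  pad-orthogonal (s≤s r≤m) orth {zero}  {zero}  i≢j = contradiction ≡.refl i≢j
  pad-orthogonal (s≤s r≤m) orth {zero}  {suc j} i≢j = ⊥-sym (pad-⊥ r≤m (λ i → orth λ ()) j)
  pad-orthogonal (s≤s r≤m) orth {suc i} {zero}  i≢j = pad-⊥ r≤m (λ i → orth λ ()) i
  pad-orthogonal (s≤s r≤m) orth {suc i} {suc j} i≢j =
    pad-orthogonal r≤m (λ i≢j → orth (i≢j ∘ Fin.suc-injective)) (i≢j ∘ ≡.cong suc)

  pad-covers : ∀ {r m p} (P : Carrierᴹ → Set p) (r≤m : r ≤ m) {B} →
    (∀ j → P (pad r≤m B j)) → ∀ i → P (B i)
  pad-covers P (s≤s r≤m) Ppad zero    = Ppad zero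
  pad-covers P (s≤s r≤m) Ppad (suc i) = pad-covers P r≤m (Ppad ∘ suc) i

  -- The first `k * m` basis vectors fill the edge blocks, the other `r` go to the root, padded by
  -- zero vectors.
  splitBasis : ∀ {k m r} → r ≤ m → {B : Fin (k * m + r) → Carrierᴹ} → Orthogonal B → Nonzero B →
    Σ[ η ∈ (Fin m → Carrierᴹ) ] Σ[ g ∈ (Fin k → Fin m → Carrierᴹ) ] OrthogonalBlocks η g ×
      (∀ (P : Carrierᴹ → Set a) → (∀ j → P (η j)) → (∀ e j → P (g e j)) → ∀ i → P (B i))
  splitBasis {k} {m} {r} r≤m {B} orth B≉0 = η , g , blocks , covers
    where
    ix : Fin k → Fin m → Fin (k * m + r)
    ix e j = combine e j ↑ˡ r

    g : Fin k → Fin m → Carrierᴹ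
    g e j = B (ix e j)

    η : Fin m → Carrierᴹ
    η = pad r≤m (B ∘ (k * m ↑ʳ_))

    ix-injective : ∀ {e e′ i j} → ix e i ≡ ix e′ j → e ≡ e′ × i ≡ j
    ix-injective eq = Fin.combine-injective _ _ _ _ (Fin.↑ˡ-injective r _ _ eq)

    ↑ʳ≢↑ˡ : ∀ i l → k * m ↑ʳ i ≢ l ↑ˡ r
    ↑ʳ≢↑ˡ i l eq with ≡.trans (≡.sym (Fin.splitAt-↑ʳ (k * m) r i))
      (≡.trans (≡.cong (splitAt (k * m)) eq) (Fin.splitAt-↑ˡ (k * m) l r))
    ... | ()

    blocks : OrthogonalBlocks η g
    blocks = record
      { η-orth    = pad-orthogonal r≤m (λ i≢j → orth (i≢j ∘ Fin.↑ʳ-injective (k * m) _ _))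
      ; g-orth    = λ e i≢j → orth (i≢j ∘ proj₂ ∘ ix-injective)
      ; g-nonzero = λ e j → B≉0 (ix e j)
      ; g⊥g       = λ i j e≢e′ → orth (e≢e′ ∘ proj₁ ∘ ix-injective)
      ; η⊥g       = λ i e j → pad-⊥ r≤m (λ l → orth (↑ʳ≢↑ˡ l (combine e j))) i
      }

    covers : ∀ (P : Carrierᴹ → Set a) → (∀ j → P (η j)) → (∀ e j → P (g e j)) → ∀ i → P (B i)
    covers P Pη Pg i with splitAt (k * m) i in eq
    ... | inj₂ l = ≡.subst (P ∘ B) (Fin.splitAt⁻¹-↑ʳ eq) (pad-covers P r≤m Pη l)
    ... | inj₁ l = ≡.subst (P ∘ B) (Fin.splitAt⁻¹-↑ˡ eq)
      (≡.subst (λ l → P (B (l ↑ˡ r))) (Fin.combine-remQuot {k} m l) (Pg _ _))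

  module _ {n m : ℕ} {T : SimpleGraph (Fin n)} {π : Fin n → Fin n} (π-injective : Injective _≡_ _≡_ π)
           (order : LeafOrder (comap π T)) where

    -- The upper bound holds since a frame is total and this one has one vector for each of the
    -- `n * m` vertices.
    frameGraph⇒bounds : ∀ {d} → HasDimension d → IsFrameGraph H (T □ complete m) →
      n * m ≤ d + m × d ≤ n * m
    frameGraph⇒bounds (e , indep , span) (N , φ , φ-frame , iso) =
      dimension-≥ order f-represents (spanning⇒total span) ,
      ≡.subst (_ ≤_) (↔⇒≡ (↔-sym Fin.*↔× ↔-∘ bijection))
        (independent⇒≤total indep (frame⇒total φ-frame))
      where
      open _≅_ iso using (bijection; adjacent)
      open Inverse bijection using (to; from; strictlyInverseˡ)
      open SimpleGraph (T □ complete m) using (_~_)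

      f : Fin n → Fin m → Carrierᴹ
      f u i = φ (from (π u , i))

      to-⊥̸ : ∀ {u v i j} → from (π u , i) ≢ from (π v , j) → ¬ (f u i ⊥ f v j) → (π u , i) ~ (π v , j)
      to-⊥̸ ≢ f⊥̸f = ≡.subst₂ _~_ (strictlyInverseˡ _) (strictlyInverseˡ _)
        (Equivalence.to (adjacent _ _) (≢ , f⊥̸f))

      from-~ : ∀ {u v i j} → (π u , i) ~ (π v , j) → ¬ (f u i ⊥ f v j)
      from-~ u~v = proj₂ (Equivalence.from (adjacent _ _)
        (≡.subst₂ _~_ (≡.sym (strictlyInverseˡ _)) (≡.sym (strictlyInverseˡ _)) u~v))

      f-represents : Represents (comap π T) f
      f-represents = record
        { nonadjacent = λ {u} {v} {i} {j} u≢v ¬adj → decidable-stable (_ 𝔽.≟ 𝔽.0#) λ f⊥̸f →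
            let from-≢ = λ eq → u≢v (π-injective (≡.cong proj₁ (≡.trans (≡.sym (strictlyInverseˡ _))
                           (≡.trans (≡.cong to eq) (strictlyInverseˡ _)))))
            in [ (λ (πu≡πv , _) → u≢v (π-injective πu≡πv))
               , (λ (i≡j , u~v) → ¬adj (u~v , i≡j)) ]′ (to-⊥̸ {u} {v} {i} {j} from-≢ f⊥̸f)
        ; adjacent    = λ u~v → from-~ (inj₂ (≡.refl , u~v))
        }

  module _ {k m : ℕ} {T : SimpleGraph (Fin (suc (suc k)))} {π : Fin (suc (suc k)) → Fin (suc (suc k))}
           (π-injective : Injective _≡_ _≡_ π) (order : LeafOrder (comap π T))
           (π-surjective : ∀ v → ∃[ u ] π u ≡ v) where
    private
      n : ℕ
      n = suc (suc k)

      open SimpleGraph T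

      π⁻¹ : Fin n → Fin n
      π⁻¹ v = proj₁ (π-surjective v)

      π∘π⁻¹ : ∀ v → π (π⁻¹ v) ≡ v
      π∘π⁻¹ v = proj₂ (π-surjective v)

      π⁻¹∘π : ∀ u → π⁻¹ (π u) ≡ u
      π⁻¹∘π u = π-injective (π∘π⁻¹ (π u))

    bounds⇒frameGraph : ∀ r → r ≤ m → HasDimension (suc k * m + r) →
      IsFrameGraph H (T □ complete m)
    bounds⇒frameGraph r r≤m dim with orthogonalBasis dim
    ... | B , orth , B≉0 , total with splitBasis {suc k} r≤m orth B≉0
    ... | η , g , blocks , B-covers = n * m , φ , φ-frame , record
      { bijection = Fin.*↔×
      ; adjacent  = λ i j → mk⇔
          (λ (i≢j , φ⊥̸φ) → ≢,⊥̸⇒~ (split i) (split j) (i≢j ∘ split-injective) φ⊥̸φ)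
          (λ q → ~⇒≢ i j q , ~⇒⊥̸ (split i) (split j) q)
      }
      where
      open Realisation (realise order blocks)
      open Represents represents
      module □ = SimpleGraph (T □ complete m)

      F : Fin n × Fin m → Carrierᴹ
      F (v , i) = f (π⁻¹ v) i

      split : Fin (n * m) → Fin n × Fin m
      split = remQuot {n} m

      φ : Fin (n * m) → Carrierᴹ
      φ = F ∘ split

      split-injective : ∀ {i j} → split i ≡ split j → i ≡ j
      split-injective {i} {j} eq = ≡.trans (≡.sym (Fin.combine-remQuot {n} m i))
        (≡.trans (≡.cong (uncurry combine) eq) (Fin.combine-remQuot {n} m j))

      ~⇒≢ : ∀ i j → split i □.~ split j → i ≢ j
      ~⇒≢ i _ i~i ≡.refl = □.loopless {split i} i~i

      ~⇒⊥̸ : ∀ x y → x □.~ y → ¬ (F x ⊥ F y)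
      -- The tree has an edge, so the exceptional alternative of `f-hasSign` is impossible.
      ~⇒⊥̸ (u , i) (v , j) (inj₁ (≡.refl , i≢j)) with f-hasSign (π⁻¹ u) i≢j
      ... | inj₂ signed = hasSign⇒≉0 (colour (π⁻¹ u)) signed
      ~⇒⊥̸ (u , i) (v , j) (inj₂ (≡.refl , u~v)) =
        adjacent (≡.subst₂ _~_ (≡.sym (π∘π⁻¹ u)) (≡.sym (π∘π⁻¹ v)) u~v)

      ≢,⊥̸⇒~ : ∀ x y → x ≢ y → ¬ (F x ⊥ F y) → x □.~ y
      ≢,⊥̸⇒~ (u , i) (v , j) x≢y F⊥̸F with u Fin.≟ v
      ... | yes ≡.refl = inj₁ (≡.refl , x≢y ∘ ≡.cong (u ,_))
      ... | no  u≢v    = decidable-stable (□.adjacent? (u , i) (v , j)) λ ¬adj →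
        F⊥̸F (nonadjacent
          (λ eq → u≢v (≡.trans (≡.sym (π∘π⁻¹ u)) (≡.trans (≡.cong π eq) (π∘π⁻¹ v))))
          (λ (u~v , i≡j) → ¬adj (inj₂ (i≡j , ≡.subst₂ _~_ (π∘π⁻¹ u) (π∘π⁻¹ v) u~v))))

      φ-frame : IsFrame φ
      φ-frame = isFrame orth B≉0 total λ P isSubspace Pφ →
        let Pf = λ u i → ≡.subst (λ u → P (f u i)) (π⁻¹∘π u)
                   (≡.subst (P ∘ F) (Fin.remQuot-combine {n} {m} (π u) i) (Pφ (combine (π u) i)))
            (Pη , Pg) = f-covers P isSubspace Pf
        in B-covers P Pη Pg

theorem3p7 :
    (ℝ : RealNumbers) (m n : ℕ) → 2 ≤ m → 2 ≤ n →
    (T : SimpleGraph (Fin n)) → IsTree T →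
    (𝔽 : ScalarField) (d : ℕ) → 1 ≤ d →
    {a ℓ : Level} (H : InnerProductSpace (scalars ℝ 𝔽) a ℓ) →
    InnerProductSpace.HasDimension H d →
    IsFrameGraph H (T □ complete m) ⇔ (m * n ∸ m ≤ d × d ≤ m * n)
theorem3p7 ℝ m n@(suc (suc k)) _ (s≤s (s≤s _)) T isTree 𝔽 d _ H dim =
  fromLeafOrder (treeLeafOrder T isTree (s≤s z≤n))
  where
  open Theorem (laws ℝ 𝔽) H
  open InnerProductSpace H using (HasDimension)

  m*n∸m≡ : m * n ∸ m ≡ suc k * m
  m*n∸m≡ = ≡.trans (≡.cong (_∸ m) (ℕ.*-comm m n)) (ℕ.m+n∸m≡n m (suc k * m))

  fromLeafOrder :
    Σ[ π ∈ (Fin n → Fin n) ] Injective _≡_ _≡_ π × LeafOrder (comap π T) × (∀ v → ∃[ i ] π i ≡ v) →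
    IsFrameGraph H (T □ complete m) ⇔ (m * n ∸ m ≤ d × d ≤ m * n)
  fromLeafOrder (π , π-injective , order , π-surjective) = mk⇔
    (λ G → let (n*m≤d+m , d≤n*m) = frameGraph⇒bounds π-injective order dim G in
      ℕ.m≤n+o⇒m∸n≤o (m * n) m (≡.subst₂ _≤_ (ℕ.*-comm n m) (ℕ.+-comm d m) n*m≤d+m) ,
      ≡.subst (d ≤_) (ℕ.*-comm n m) d≤n*m)
    -- The `n - 1` edges use `m` dimensions each; what remains of `d`, at most `m`, goes to the
    -- root.
    (λ (m*n∸m≤d , d≤m*n) → bounds⇒frameGraph π-injective order π-surjective (d ∸ suc k * m)
      (ℕ.m≤n+o⇒m∸n≤o d (suc k * m)
        (≡.subst (d ≤_) (≡.trans (ℕ.*-comm m n) (ℕ.+-comm m (suc k * m))) d≤m*n))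
      (≡.subst HasDimension (≡.sym (ℕ.m+[n∸m]≡n (≡.subst (_≤ d) m*n∸m≡ m*n∸m≤d))) dim))
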